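{- Let $W$ be a finite Coxeter group and $c$ a standard Coxeter element of $W$. For each $u\in W_c^+$, the set $\mathrm{Class}_c(u)$ contains the $\preceq_c$-increasing commutation class $\mathcal I_c$ and contains exactly one $\preceq_c$-decreasing commutation class.
   Context: Let $W$ be a finite Coxeter group of rank $r$ with simple reflections $S$ and set of reflections $T$; $\ell_S$ and $\ell_T$ denote length with respect to $S$ and $T$. Bruhat order $\leq_{\mathrm B}$: covers $u\lessdot_{\mathrm B}v$ iff $v=ut$ with $t\in T$ and $\ell_S(v)=\ell_S(u)+1$. Absolute order: $u\leq_T v$ iff $\ell_T(u)+\ell_T(u^{ -1}v)=\ell_T(v)$. A standard Coxeter element $c$ is a product of all elements of $S$ each once in some order; $\ell_S(c)=\ell_T(c)=r$. Let $\mathsf{MC}(W,c)$ be the set of maximal chains $\vec\pi=\{e=\pi_0\lessdot_T\pi_1\lessdot_T\cdots\lessdot_T\pi_r=c\}$ of the interval $[e,c]_T$ (the $c$-noncrossing partition lattice), and let $\mathrm{rw}(\vec\pi)=t_1\cdots t_r$ with $t_i=\pi_{i-1}^{ -1}\pi_i\in T$ (a reduced $T$-word for $c$). Two chains are commutation equivalent if their words $\mathrm{rw}$ are related by swapping adjacent commuting letters; $\mathcal C_{\vec\pi}$ denotes the class of $\vec\pi$. Let $W_c^+=\{u\in W:\ell_S(uc)=\ell_S(u)+r\}$. An element $u\in W_c^+$ and $\vec\pi\in\mathsf{MC}(W,c)$ are concordant if $u\pi_0\leq_{\mathrm B}u\pi_1\leq_{\mathrm B}\cdots\leq_{\mathrm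 B}u\pi_r$; $\mathrm{Class}_c(u)$ is the set of commutation classes of chains concordant with $u$ (concordance is constant on classes). The order $\preceq_c$ on $T$: fix a reduced $S$-word $\mathsf c$ for $c$; the $c$-sorting word of $w\in W$ is the lexicographically first (by positions) subword of $\mathsf c\mathsf c\mathsf c\cdots$ that is a reduced $S$-word for $w$. The inversion sequence of a reduced $S$-word $s_1\cdots s_k$ is $(t_1,\ldots,t_k)$ with $t_i=s_1\cdots s_{i-1}s_is_{i-1}\cdots s_1$. Declare $t\preceq_c t'$ if $t$ appears to the left of $t'$ in the inversion sequence of every reduced $S$-word for the longest element $w_\circ$ obtained from the $c$-sorting word of $w_\circ$ by swapping adjacent commuting letters. A chain with $\mathrm{rw}(\vec\pi)=t_1\cdots t_r$ is $\preceq_c$-increasing (resp. $\preceq_c$-decreasing) if there are no $i<j$ with $t_j\preceq_c t_i$ (resp. $t_i\preceq_c t_j$); this property is constant on commutation classes. It is known that there is a unique $\preceq_c$-increasing class, denoted $\mathcal I_c$. -}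

module Defs where

open import Level using (0ℓ)
open import Data.Nat using (ℕ; zero; suc; _+_; _*_; _≤_; _<_)
open import Data.Fin using (Fin; toℕ)
open import Data.List using (List; []; _∷_; length; map; foldr; lookup)
open import Data.List.Membership.Propositional using (_∈_)
open import Data.List.Relation.Unary.All using (All)
open import Data.List.Relation.Unary.AllPairs using (AllPairs)
open import Data.List.Relation.Unary.Linked using (Linked)
open import Data.Product using (Σ; ∃; ∃-syntax; _×_; _,_)
open import Data.Sum using (_⊎_)
open import Relation.Binary.PropositionalEquality using (_≡_; _≢_)
open import Relation.Binary.Definitions using (DecidableEquality)
open import Relation.Nullary using (¬_)
open import Algebra.Structures using (IsGroup)
open import Algebra.Bundles using (Group)
open import Relation.Binary.Construct.Closure.ReflexiveTransitive using (Star)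
open import Function.Definitions using (Injective)

pow : {A : Set} → (A → A → A) → A → A → ℕ → A
pow _∙_ ε x zero    = ε
pow _∙_ ε x (suc n) = x ∙ pow _∙_ ε x n

lastOr : {A : Set} → A → List A → A
lastOr x []       = x
lastOr x (y ∷ ys) = lastOr y ys

data SwapBy {A : Set} (comm : A → A → Set) : List A → List A → Set where
  here  : ∀ {a b xs} → comm a b → SwapBy comm (a ∷ b ∷ xs) (b ∷ a ∷ xs)
  there : ∀ {x xs ys} → SwapBy comm xs ys → SwapBy comm (x ∷ xs) (x ∷ ys)

CommEqBy : {A : Set} → (A → A → Set) → List A → List A → Set
CommEqBy comm = Star (SwapBy comm)

data LexLeq : List ℕ → List ℕ → Set where
  nil   : ∀ {ys} → LexLeq [] ys
  less  : ∀ {x y xs ys} → x < y → LexLeq (x ∷ xs) (y ∷ ys)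
  equal : ∀ {x xs ys} → LexLeq xs ys → LexLeq (x ∷ xs) (x ∷ ys)

-- A finite Coxeter system (W, S) of rank r, S = {s i | i : Fin r}.
-- W is a finite group (equality is propositional equality, decidable)
-- generated by the distinct non-trivial involutions s i, and (W,S) has the
-- Coxeter presentation < S | (s t)^{m(s,t)} = e >, m(s,t) = order of s t,
-- expressed by its universal property.

record FiniteCoxeterSystem : Set₁ where
  infixl 7 _·_
  field
    W            : Set
    _·_          : W → W → W
    e            : W
    _⁻¹          : W → W
    isGroup      : IsGroup _≡_ _·_ e _⁻¹
    _≟_          : DecidableEquality W
    elements     : List W
    finite       : ∀ w → w ∈ elements
    rank         : ℕ
    s            : Fin rank → W
    s-injective  : Injective _≡_ _≡_ s
    s-nontrivial : ∀ i → s i ≢ e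
    s-involution : ∀ i → s i · s i ≡ e
    generated    : ∀ w → ∃[ a ] foldr (λ i x → s i · x) e a ≡ w
    presentation :
      (G : Group 0ℓ 0ℓ) (f : Fin rank → Group.Carrier G) →
      (∀ i j n → 0 < n → pow _·_ e (s i · s j) n ≡ e →
         (∀ k → 0 < k → k < n → pow _·_ e (s i · s j) k ≢ e) →
         Group._≈_ G (pow (Group._∙_ G) (Group.ε G) (Group._∙_ G (f i) (f j)) n) (Group.ε G)) →
      Σ (W → Group.Carrier G) λ φ →
        (∀ x y → Group._≈_ G (φ (x · y)) (Group._∙_ G (φ x) (φ y))) ×
        (∀ i → Group._≈_ G (φ (s i)) (f i))

module Notions (C : FiniteCoxeterSystem) where
  open FiniteCoxeterSystem C

  r : ℕ
  r = rank

  prod : List (Fin r) → W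
  prod = foldr (λ i x → s i · x) e

  prodW : List W → W
  prodW = foldr _·_ e

  LenS : W → ℕ → Set
  LenS w n = (∃[ a ] (length a ≡ n × prod a ≡ w)) × (∀ a → prod a ≡ w → n ≤ length a)

  ReducedFor : W → List (Fin r) → Set
  ReducedFor w a = prod a ≡ w × LenS w (length a)

  IsReflection : W → Set
  IsReflection t = ∃[ w ] ∃[ i ] t ≡ w · s i · w ⁻¹

  LenT : W → ℕ → Set
  LenT w n = (∃[ ts ] (All IsReflection ts × length ts ≡ n × prodW ts ≡ w))
           × (∀ ts → All IsReflection ts → prodW ts ≡ w → n ≤ length ts)

  BruhatCover : W → W → Set
  BruhatCover u v = ∃[ t ] (IsReflection t × v ≡ u · t × ∃[ n ] (LenS u n × LenS v (suc n)))

  _≤B_ : W → W → Set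
  _≤B_ = Star BruhatCover

  _≤T_ : W → W → Set
  u ≤T v = ∃[ a ] ∃[ b ] ∃[ d ] (LenT u a × LenT (u ⁻¹ · v) b × LenT v d × a + b ≡ d)

  _⋖T_ : W → W → Set
  u ⋖T v = u ≤T v × u ≢ v × (∀ w → u ≤T w → w ≤T v → w ≡ u ⊎ w ≡ v)

  -- A chain π_0 < π_1 < ... < π_k is represented by the list (π_1 ... π_k),
  -- with π_0 = e.  Maximal chains of [e,c]_T are the saturated chains
  -- e = π_0 ⋖T π_1 ⋖T ... ⋖T π_k = c.
  MaxChain : W → List W → Set
  MaxChain c π = Linked _⋖T_ (e ∷ π) × lastOr e π ≡ c

  rwFrom : W → List W → List W
  rwFrom x []       = []
  rwFrom x (y ∷ ys) = (x ⁻¹ · y) ∷ rwFrom y ys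

  rw : List W → List W
  rw π = rwFrom e π

  CommEquiv : List W → List W → Set
  CommEquiv π π′ = CommEqBy (λ a b → a · b ≡ b · a) (rw π) (rw π′)

  InWcPlus : W → W → Set
  InWcPlus c u = ∃[ n ] (LenS u n × LenS (u · c) (n + r))

  Concordant : W → List W → Set
  Concordant u π = Linked _≤B_ (map (u ·_) (e ∷ π))

  IsLongest : W → Set
  IsLongest w₀ = ∀ v n m → LenS v n → LenS w₀ m → n ≤ m

  -- inversion sequence of an S-word:
  -- t_i = s_1 ... s_{i-1} s_i s_{i-1} ... s_1
  inversions : List (Fin r) → List W
  inversions []       = []
  inversions (i ∷ a) = s i ∷ map (λ t → s i · t · s i) (inversions a)

  -- c-sorting word.  𝖼 is a fixed reduced word for c.  A position in
  -- 𝖼𝖼𝖼⋯ is a pair (k , i): the i-th letter of the k-th copy of 𝖼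
  -- (absolute position k * |𝖼| + i).
  module Sorting (𝖼 : List (Fin r)) where

    Pos : Set
    Pos = ℕ × Fin (length 𝖼)

    key : Pos → ℕ
    key (k , i) = k * length 𝖼 + toℕ i

    letters : List Pos → List (Fin r)
    letters = map (λ p → lookup 𝖼 (Data.Product.proj₂ p))

    Subword : List Pos → Set
    Subword = Linked (λ p q → key p < key q)

    SortingPositions : W → List Pos → Set
    SortingPositions w ps =
      Subword ps × ReducedFor w (letters ps) ×
      (∀ qs → Subword qs → ReducedFor w (letters qs) → LexLeq (map key ps) (map key qs))

  open Sorting

  LeftOf : W → W → List W → Set
  LeftOf t t′ ts = ∃[ i ] ∃[ j ] (toℕ i ≤ toℕ j × lookup ts i ≡ t × lookup ts j ≡ t′)

  _≼[_]_ : W → List (Fin r) → W → Set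
  t ≼[ 𝖼 ] t′ = ∀ w₀ → IsLongest w₀ → ∀ ps → SortingPositions 𝖼 w₀ ps →
                ∀ a → CommEqBy (λ i j → s i · s j ≡ s j · s i) (letters 𝖼 ps) a →
                LeftOf t t′ (inversions a)

  Increasing : List (Fin r) → List W → Set
  Increasing 𝖼 π = AllPairs (λ ti tj → ¬ (tj ≼[ 𝖼 ] ti)) (rw π)

  Decreasing : List (Fin r) → List W → Set
  Decreasing 𝖼 π = AllPairs (λ ti tj → ¬ (ti ≼[ 𝖼 ] tj)) (rw π)

{-# OPTIONS --safe #-}
module Submission where

-- Let u be in W_c⁺. Since ℓ_S(uc) = ℓ_S(u) + r and ℓ_T(c) = r, the chains concordant with u
-- are the maximal chains of the Bruhat interval [u, uc], each step labelled by a reflection.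
-- The inversion sequence of the c-sorting word of w₀ is a reflection order, and for such an
-- order Dyer's theorem gives exactly one increasing and exactly one decreasing maximal chain.
-- To pass from this total order to ≼_c, note that swapping commuting letters of a reduced
-- word swaps commuting reflections in its inversion sequence, so non-commuting reflections
-- are always comparable for ≼_c; hence a ≼_c-decreasing chain can be sorted into the
-- decreasing chain by commutations, and these preserve concordance.
--
-- Dyer's theorem is obtained by expanding a product T_v T_{w₀} in the Hecke algebra in two
-- ways. Along a reduced word of w₀ the terms are the descending walks from v whose labels
-- increase for the reflection order; along a reduced word of v there is only one term of the
-- relevant degree. The two expansions agree since left and right multiplications commute.
--
-- ℓ_T(c) = r also follows Dyer: a shortest path of reflections from e to w can be made
-- increasing by lowering its peaks inside dihedral subgroups, and by the exchange condition
-- such a path deletes ℓ_T(w) letters from any word of w, leaving a word of e.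

open import Defs
open import Level using (0ℓ)
open import Algebra.Bundles using (Group)
import Algebra.Properties.Group as GroupProperties
open import Data.Bool using (Bool; true; false; not; _xor_)
open import Data.Bool.Properties using (xor-assoc; xor-comm; xor-same) renaming (_≟_ to _≟ᵇ_)
open import Data.Empty using (⊥)
open import Data.Fin using (Fin; toℕ; fromℕ<) renaming (zero to fzero; suc to fsuc)
open import Data.Fin.Properties using (toℕ-injective; toℕ-fromℕ<; toℕ<n; nonZeroIndex)
open import Data.List using (List; []; _∷_; _++_; length; map; allFin; reverse; lookup)
open import Data.List.Membership.Propositional using (_∈_)
open import Data.List.Membership.Propositional.Properties using (∈-map⁺; ∈-map⁻; ∈-lookup; ∈-allFin)
open import Data.List.Properties using (length-++; length-map; length-tabulate; length-reverse; reverse-map; ++-assoc; map-∘; map-cong; map-id; map-injective; unfold-reverse; reverse-involutive)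
open import Data.List.Relation.Unary.Any as Any using (here; there)
open import Data.List.Relation.Unary.Any.Properties using (lookup-index) renaming (reverse⁻ to Any-reverse⁻)
open import Data.List.Relation.Unary.All as All using (All; []; _∷_)
open import Data.List.Relation.Unary.All.Properties using () renaming (++⁺ to All-++⁺; ++⁻ˡ to All-++⁻ˡ; ++⁻ʳ to All-++⁻ʳ)
open import Data.List.Relation.Unary.AllPairs as AllPairs using (AllPairs; []; _∷_)
open import Data.List.Relation.Unary.Linked using (Linked; []; [-]; _∷_)
open import Data.List.Relation.Unary.Unique.Propositional using (Unique)
open import Data.List.Relation.Unary.Unique.Propositional.Properties using (allFin⁺) renaming (map⁺ to Unique-map⁺)
open import Data.List.Relation.Binary.Permutation.Propositional using (_↭_; ↭-sym; ↭⇒↭ₛ)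
open import Data.List.Relation.Binary.Permutation.Propositional.Properties using (↭-length; ∈-resp-↭)
import Data.List.Relation.Binary.Permutation.Setoid.Properties as PermutationProperties
open import Data.List.Relation.Binary.Sublist.Propositional using (_⊆_; []; _∷_; _∷ʳ_; ⊆-refl; ⊆-trans; from∈; to∈) renaming (lookup to ⊆-lookup)
open import Data.List.Relation.Binary.Sublist.Propositional.Properties using (length-mono-≤; All-resp-⊆)
open import Data.Maybe using (Maybe; just; nothing)
open import Data.Nat using (ℕ; zero; suc; _+_; _*_; _≤_; _<_; z≤n; s≤s; NonZero)
open import Data.Nat.DivMod using (_/_; _%_; m%n<n; m≡m%n+[m/n]*n; [m+kn]%n≡m%n; m<n⇒m%n≡m)
open import Data.Nat.Induction using (<-wellFounded)
open import Data.Nat.Properties using () renaming (_≟_ to _≟ℕ_)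
open import Data.Nat.Properties hiding (_≟_)
open import Data.List.Extrema ≤-totalOrder using (argmax; f[xs]≤f[argmax])
open import Data.Product using (Σ; ∃-syntax; _×_; _,_; proj₁; proj₂)
open import Data.Sum using (_⊎_; inj₁; inj₂)
open import Induction.WellFounded using (Acc; acc)
open import Relation.Binary.Construct.Closure.ReflexiveTransitive using (ε; _◅_; _◅◅_; gmap)
open import Relation.Binary.PropositionalEquality using (_≡_; _≢_; refl; sym; trans; cong; cong₂; subst; setoid; module ≡-Reasoning)
open import Relation.Nullary using (¬_; Dec; yes; no; contradiction)
open import Relation.Nullary.Decidable using (⌊_⌋)

-- Order of occurrence in lists, and sorting by commutations.

module _ {A : Set} where

  AllPairs-⊆ : ∀ {Q : A → A → Set} {xs ys} → xs ⊆ ys → AllPairs Q ys → AllPairs Q xs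
  AllPairs-⊆ []         []         = []
  AllPairs-⊆ (_ ∷ʳ p)   (_ ∷ qs)   = AllPairs-⊆ p qs
  AllPairs-⊆ (refl ∷ p) (q ∷ qs)   = All-resp-⊆ p q ∷ AllPairs-⊆ p qs

  AllPairs-∷ʳ : ∀ {Q : A → A → Set} {xs x} → AllPairs Q xs → All (λ y → Q y x) xs → AllPairs Q (xs ++ x ∷ [])
  AllPairs-∷ʳ []       []       = [] ∷ []
  AllPairs-∷ʳ (p ∷ ps) (q ∷ qs) = All-++⁺ p (q ∷ []) ∷ AllPairs-∷ʳ ps qs

  All-reverse : ∀ {Q : A → Set} {xs} → All Q xs → All Q (reverse xs)
  All-reverse p = All.tabulate λ x∈ → All.lookup p (Any-reverse⁻ x∈)

  AllPairs-reverse : ∀ {Q : A → A → Set} {xs} → AllPairs Q xs → AllPairs (λ x y → Q y x) (reverse xs)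
  AllPairs-reverse [] = []
  AllPairs-reverse {xs = x ∷ xs} (p ∷ ps) rewrite unfold-reverse x xs = AllPairs-∷ʳ (AllPairs-reverse ps) (All-reverse p)

  -- Throughout, `(x ∷ y ∷ []) ⊆ xs` encodes that `x` occurs before `y` in `xs`, without any
  -- bookkeeping of positions.
  precedes-self : (xs : List A) → AllPairs (λ x y → (x ∷ y ∷ []) ⊆ xs) xs
  precedes-self []       = []
  precedes-self (x ∷ xs) = All.tabulate (λ y∈ → refl ∷ from∈ y∈) ∷ AllPairs.map (x ∷ʳ_) (precedes-self xs)

  precedes-asym : ∀ {xs : List A} {x y} → Unique xs → (x ∷ y ∷ []) ⊆ xs → (y ∷ x ∷ []) ⊆ xs → ⊥
  precedes-asym (_ ∷ u) (_ ∷ʳ p)   (_ ∷ʳ q)   = precedes-asym u p q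
  precedes-asym (x∉ ∷ _) (_ ∷ʳ p)  (refl ∷ q) = All.lookup x∉ (to∈ (⊆-trans (_ ∷ʳ ⊆-refl) p)) refl
  precedes-asym (x∉ ∷ _) (refl ∷ p) (_ ∷ʳ q)  = All.lookup x∉ (to∈ (⊆-trans (_ ∷ʳ ⊆-refl) q)) refl
  precedes-asym (x∉ ∷ _) (refl ∷ p) (refl ∷ q) = All.lookup x∉ (to∈ p) refl

  module _ {comm : A → A → Set} where

    SwapBy-++ : ∀ zs {xs ys} → SwapBy comm xs ys → SwapBy comm (xs ++ zs) (ys ++ zs)
    SwapBy-++ zs (here c)  = here c
    SwapBy-++ zs (there p) = there (SwapBy-++ zs p)

    SwapBy-prefix : ∀ zs {xs ys} → SwapBy comm xs ys → SwapBy comm (zs ++ xs) (zs ++ ys)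
    SwapBy-prefix []       p = p
    SwapBy-prefix (z ∷ zs) p = there (SwapBy-prefix zs p)

    ∈-SwapBy : ∀ {xs ys z} → SwapBy comm xs ys → z ∈ xs → z ∈ ys
    ∈-SwapBy (here _)  (here p)          = there (here p)
    ∈-SwapBy (here _)  (there (here p))  = here p
    ∈-SwapBy (here _)  (there (there p)) = there (there p)
    ∈-SwapBy (there s) (here p)          = here p
    ∈-SwapBy (there s) (there p)         = there (∈-SwapBy s p)

    -- Only the two swapped letters change their relative order, and these commute.
    SwapBy-precedes : ∀ {xs ys x y} → ¬ comm x y → SwapBy comm xs ys → (x ∷ y ∷ []) ⊆ xs → (x ∷ y ∷ []) ⊆ ys
    SwapBy-precedes ¬c (here c) (_ ∷ʳ _ ∷ʳ p)       = _ ∷ʳ _ ∷ʳ p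
    SwapBy-precedes ¬c (here c) (_ ∷ʳ (refl ∷ p))   = refl ∷ (_ ∷ʳ p)
    SwapBy-precedes ¬c (here c) (refl ∷ (_ ∷ʳ p))   = _ ∷ʳ (refl ∷ p)
    SwapBy-precedes ¬c (here c) (refl ∷ (refl ∷ p)) = contradiction c ¬c
    SwapBy-precedes ¬c (there s) (_ ∷ʳ p)   = _ ∷ʳ SwapBy-precedes ¬c s p
    SwapBy-precedes ¬c (there s) (refl ∷ p) = refl ∷ from∈ (∈-SwapBy s (to∈ p))

    module _ (comm-sym : ∀ {x y} → comm x y → comm y x) where

      SwapBy-sym : ∀ {xs ys} → SwapBy comm xs ys → SwapBy comm ys xs
      SwapBy-sym (here c)  = here (comm-sym c)
      SwapBy-sym (there p) = there (SwapBy-sym p)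

      CommEqBy-sym : ∀ {xs ys} → CommEqBy comm xs ys → CommEqBy comm ys xs
      CommEqBy-sym ε        = ε
      CommEqBy-sym (p ◅ ps) = CommEqBy-sym ps ◅◅ (SwapBy-sym p ◅ ε)

      SwapBy-reverse : ∀ {xs ys} → SwapBy comm xs ys → SwapBy comm (reverse xs) (reverse ys)
      SwapBy-reverse (here {a} {b} {xs} c)
        rewrite unfold-reverse a (b ∷ xs) | unfold-reverse b xs | unfold-reverse b (a ∷ xs) | unfold-reverse a xs
              | ++-assoc (reverse xs) (b ∷ []) (a ∷ []) | ++-assoc (reverse xs) (a ∷ []) (b ∷ []) =
        SwapBy-prefix (reverse xs) (here (comm-sym c))
      SwapBy-reverse (there {x} {xs} {ys} p) rewrite unfold-reverse x xs | unfold-reverse x ys = SwapBy-++ (x ∷ []) (SwapBy-reverse p)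

      CommEqBy-reverse : ∀ {xs ys} → CommEqBy comm xs ys → CommEqBy comm (reverse xs) (reverse ys)
      CommEqBy-reverse = gmap reverse SwapBy-reverse

    -- The hypothesis makes every letter in front of `z` commute with it, so `z` can be moved to the
    -- head by swaps.
    extract : ∀ {z xs} → z ∈ xs → Unique xs → AllPairs (λ x y → y ≡ z → comm x y) xs →
      ∃[ ys ] (ys ⊆ xs × All (z ≢_) ys × CommEqBy comm xs (z ∷ ys))
    extract {xs = z ∷ xs} (here refl) (z∉ ∷ _) _ = xs , z ∷ʳ ⊆-refl , z∉ , ε
    extract {z} {x ∷ xs} (there z∈) (x∉ ∷ ux) (h ∷ hs) with extract z∈ ux hs
    ... | ys , ys⊆ , z∉ , c = x ∷ ys , refl ∷ ys⊆ , (λ { refl → All.lookup x∉ z∈ refl }) ∷ z∉ ,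
          gmap (x ∷_) there c ◅◅ (here (All.lookup h z∈ refl) ◅ ε)

    drop-head : ∀ {x z} {zs : List A} → z ≢ x → x ∈ z ∷ zs → x ∈ zs
    drop-head z≢x (here refl) = contradiction refl z≢x
    drop-head _   (there p)   = p

    -- As `z` heads `z ∷ zs`, any letter of `xs` in front of `z` forms an inverted pair with it.
    -- This supplies the hypothesis of `extract`.
    inverted-commute : ∀ {z zs xs} → Unique xs → All (_∈ z ∷ zs) xs →
      AllPairs (λ x y → (y ∷ x ∷ []) ⊆ z ∷ zs → comm x y) xs → AllPairs (λ x y → y ≡ z → comm x y) xs
    inverted-commute []        []       []       = []
    inverted-commute (x∉ ∷ ux) (m ∷ ms) (h ∷ hs) =
      All.map (λ { (f , x≢y) refl → f (refl ∷ from∈ (drop-head (λ q → x≢y (sym q)) m)) }) (All.zip (h , x∉))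
      ∷ inverted-commute ux ms hs

    -- Selection sort along the linear order given by zs: every inverted pair commutes.
    sort : (∀ (x y : A) → Dec (x ≡ y)) → ∀ zs xs → Unique xs → All (_∈ zs) xs →
      AllPairs (λ x y → (y ∷ x ∷ []) ⊆ zs → comm x y) xs → ∃[ ys ] (ys ⊆ zs × CommEqBy comm xs ys)
    sort _≟_ []       []       _  _  _  = [] , [] , ε
    sort _≟_ []       (x ∷ xs) _  (() ∷ _) _
    sort _≟_ (z ∷ zs) xs       ux xs∈ cs with Any.any? (z ≟_) xs
    ... | no z∉ = let ys , ys⊆ , c = sort _≟_ zs xs ux
                        (All.tabulate λ x∈ → drop-head (λ { refl → z∉ x∈ }) (All.lookup xs∈ x∈))
                        (AllPairs.map (λ f p → f (z ∷ʳ p)) cs)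
                  in ys , z ∷ʳ ys⊆ , c
    ... | yes z∈ = let
                     xs′ , xs′⊆ , z∉ , c = extract z∈ ux (inverted-commute ux xs∈ cs)
                     ys , ys⊆ , c′ = sort _≟_ zs xs′ (AllPairs-⊆ xs′⊆ ux)
                       (All.map (λ (z≢x , x∈) → drop-head z≢x x∈) (All.zip (z∉ , All-resp-⊆ xs′⊆ xs∈)))
                       (AllPairs.map (λ f p → f (z ∷ʳ p)) (AllPairs-⊆ xs′⊆ cs))
                   in z ∷ ys , refl ∷ ys⊆ , c ◅◅ gmap (z ∷_) there c′

xor-cancel : ∀ {x y} → x xor y ≡ false → x ≡ y
xor-cancel {true}  {true}  _ = refl
xor-cancel {false} {false} _ = refl

-- The group of a Coxeter system and a solver for its word identities.

module Coxeter (C : FiniteCoxeterSystem) where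
  open FiniteCoxeterSystem C public
  open Notions C public

  group : Group 0ℓ 0ℓ
  group = record { isGroup = isGroup }

  open Group group public using (assoc; identityˡ; identityʳ; inverseˡ; inverseʳ)
  open GroupProperties group public using (⁻¹-involutive; ⁻¹-anti-homo-∙; ε⁻¹≈ε; ∙-cancelˡ; ∙-cancelʳ; inverseˡ-unique; inverseʳ-unique; identityˡ-unique; identityʳ-unique)

  -- In Solver.Expr, V n ranges over arbitrary elements and I n over involutions; two
  -- expressions are compared after free cancellation.
  module Solver where
    infixl 7 _⊙_
    infix 8 _⁻

    data Expr : Set where
      V I : ℕ → Expr
      ⟨e⟩ : Expr
      _⊙_ : Expr → Expr → Expr
      _⁻  : Expr → Expr

    data Letter : Set where
      pos neg inv : ℕ → Letter

    opp : Letter → Letter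
    opp (pos n) = neg n
    opp (neg n) = pos n
    opp (inv n) = inv n

    Involution : Set
    Involution = Σ W λ x → x · x ≡ e

    module _ (Γ : List W) (Δ : List Involution) where

      nth : ℕ → List W → W
      nth _       []       = e
      nth zero    (x ∷ _)  = x
      nth (suc n) (_ ∷ xs) = nth n xs

      nthI : ℕ → List Involution → Involution
      nthI _       []       = e , identityˡ e
      nthI zero    (x ∷ _)  = x
      nthI (suc n) (_ ∷ xs) = nthI n xs

      ⟦_⟧ : Expr → W
      ⟦ V n ⟧   = nth n Γ
      ⟦ I n ⟧   = proj₁ (nthI n Δ)
      ⟦ ⟨e⟩ ⟧   = e
      ⟦ a ⊙ b ⟧ = ⟦ a ⟧ · ⟦ b ⟧
      ⟦ a ⁻ ⟧   = ⟦ a ⟧ ⁻¹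

      ⟦_⟧ₗ : Letter → W
      ⟦ pos n ⟧ₗ = nth n Γ
      ⟦ neg n ⟧ₗ = nth n Γ ⁻¹
      ⟦ inv n ⟧ₗ = proj₁ (nthI n Δ)

      ⟦_⟧ʷ : List Letter → W
      ⟦ [] ⟧ʷ    = e
      ⟦ l ∷ w ⟧ʷ = ⟦ l ⟧ₗ · ⟦ w ⟧ʷ

      opp-inverse : ∀ l → ⟦ l ⟧ₗ · ⟦ opp l ⟧ₗ ≡ e
      opp-inverse (pos n) = inverseʳ _
      opp-inverse (neg n) = inverseˡ _
      opp-inverse (inv n) = proj₂ (nthI n Δ)

      opp⇒⁻¹ : ∀ l → ⟦ opp l ⟧ₗ ≡ ⟦ l ⟧ₗ ⁻¹
      opp⇒⁻¹ l = inverseʳ-unique _ _ (opp-inverse l)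

    opposite? : ∀ l m → Maybe (m ≡ opp l)
    opposite? (pos m) (neg n) with m ≟ℕ n
    ... | yes refl = just refl
    ... | no _     = nothing
    opposite? (neg m) (pos n) with m ≟ℕ n
    ... | yes refl = just refl
    ... | no _     = nothing
    opposite? (inv m) (inv n) with m ≟ℕ n
    ... | yes refl = just refl
    ... | no _     = nothing
    opposite? _ _ = nothing

    cons : Letter → List Letter → List Letter
    cons l []      = l ∷ []
    cons l (m ∷ w) with opposite? l m
    ... | just _  = w
    ... | nothing = l ∷ m ∷ w

    append : List Letter → List Letter → List Letter
    append []      w = w
    append (l ∷ v) w = cons l (append v w)

    invert : List Letter → List Letter
    invert []      = []
    invert (l ∷ w) = append (invert w) (opp l ∷ [])

    norm : Expr → List Letter
    norm (V n)   = pos n ∷ []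
    norm (I n)   = inv n ∷ []
    norm ⟨e⟩     = []
    norm (a ⊙ b) = append (norm a) (norm b)
    norm (a ⁻)   = invert (norm a)

    module _ (Γ : List W) (Δ : List Involution) where

      private
        ev  = ⟦_⟧ Γ Δ
        evₗ = ⟦_⟧ₗ Γ Δ
        evʷ = ⟦_⟧ʷ Γ Δ

      cons-correct : ∀ l w → evʷ (cons l w) ≡ evₗ l · evʷ w
      cons-correct l []      = refl
      cons-correct l (m ∷ w) with opposite? l m
      ... | nothing   = refl
      ... | just refl = sym (trans (sym (assoc _ _ _)) (trans (cong (_· evʷ w) (opp-inverse Γ Δ l)) (identityˡ _)))

      append-correct : ∀ v w → evʷ (append v w) ≡ evʷ v · evʷ w
      append-correct []      w = sym (identityˡ _)
      append-correct (l ∷ v) w = trans (cons-correct l (append v w)) (trans (cong (evₗ l ·_) (append-correct v w)) (sym (assoc _ _ _)))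

      invert-correct : ∀ w → evʷ (invert w) ≡ evʷ w ⁻¹
      invert-correct []      = sym ε⁻¹≈ε
      invert-correct (l ∷ w) = trans (append-correct (invert w) _)
        (trans (cong₂ _·_ (invert-correct w) (trans (identityʳ _) (opp⇒⁻¹ Γ Δ l))) (sym (⁻¹-anti-homo-∙ _ _)))

      norm-correct : ∀ a → evʷ (norm a) ≡ ev a
      norm-correct (V n)   = identityʳ _
      norm-correct (I n)   = identityʳ _
      norm-correct ⟨e⟩     = refl
      norm-correct (a ⊙ b) = trans (append-correct (norm a) (norm b)) (cong₂ _·_ (norm-correct a) (norm-correct b))
      norm-correct (a ⁻)   = trans (invert-correct (norm a)) (cong _⁻¹ (norm-correct a))

      solve : ∀ a b → norm a ≡ norm b → ev a ≡ ev b
      solve a b eq = trans (sym (norm-correct a)) (trans (cong evʷ eq) (norm-correct b))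

  open Solver using (V; I; ⟨e⟩; _⊙_; _⁻; solve; Involution)

  σ : Fin r → Involution
  σ i = s i , s-involution i

  infix 4 _==_
  _==_ : W → W → Bool
  x == y = ⌊ x ≟ y ⌋

  ==-refl : ∀ x → (x == x) ≡ true
  ==-refl x with x ≟ x
  ... | yes _ = refl
  ... | no q = contradiction refl q

  ==-false : ∀ {x y} → x ≢ y → (x == y) ≡ false
  ==-false {x} {y} q with x ≟ y
  ... | yes p = contradiction p q
  ... | no _ = refl

  ==-true : ∀ {x y} → (x == y) ≡ true → x ≡ y
  ==-true {x} {y} eq with x ≟ y
  ... | yes p = p

  ==-cong : ∀ {x y x′ y′} → (x ≡ y → x′ ≡ y′) → (x′ ≡ y′ → x ≡ y) → (x == y) ≡ (x′ == y′)
  ==-cong {x} {y} {x′} {y′} f g with x ≟ y | x′ ≟ y′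
  ... | yes _ | yes _ = refl
  ... | yes p | no q = contradiction (f p) q
  ... | no q | yes p = contradiction (g p) q
  ... | no _ | no _ = refl

  -- Inversion sets as a cocycle obtained from the Coxeter presentation.

  mirror : (W → Bool) × W → (W → Bool) × W → (W → Bool) × W
  mirror (M , x) (M′ , y) = (λ t → M t xor M′ (x ⁻¹ · t · x)) , x · y

  _≈ₘ_ : (W → Bool) × W → (W → Bool) × W → Set
  (M , x) ≈ₘ (M′ , y) = (∀ t → M t ≡ M′ t) × x ≡ y

  -- The semidirect product of the functions `W → Bool` under xor by `W` acting through conjugation.
  -- A homomorphism into it that lifts the identity of `W` is a cocycle, so the universal property
  -- defines inversion sets before anything is known about lengths.
  mirrorGroup : Group 0ℓ 0ℓ
  mirrorGroup = record
    { Carrier = (W → Bool) × W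
    ; _≈_ = _≈ₘ_
    ; _∙_ = mirror
    ; ε = (λ _ → false) , e
    ; _⁻¹ = λ (M , x) → (λ t → M (x · t · x ⁻¹)) , x ⁻¹
    ; isGroup = record
      { isMonoid = record
        { isSemigroup = record
          { isMagma = record
            { isEquivalence = record
              { refl = (λ _ → refl) , refl
              ; sym = λ (p , q) → (λ t → sym (p t)) , sym q
              ; trans = λ (p , q) (p′ , q′) → (λ t → trans (p t) (p′ t)) , trans q q′ }
            ; ∙-cong = λ { {_ , x} {_ , .x} (p , refl) (q , refl) → (λ t → cong₂ _xor_ (p t) (q _)) , refl } }
          ; assoc = λ (M , x) (M′ , y) (M″ , z) →
              (λ t → trans (xor-assoc (M t) _ _)
                (cong (λ u → M t xor (M′ (x ⁻¹ · t · x) xor M″ u))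
                  (solve (x ∷ y ∷ t ∷ []) [] ((V 0 ⊙ V 1) ⁻ ⊙ V 2 ⊙ (V 0 ⊙ V 1)) (V 1 ⁻ ⊙ (V 0 ⁻ ⊙ V 2 ⊙ V 0) ⊙ V 1) refl)))
              , assoc x y z }
        ; identity =
            (λ (M , x) → (λ t → cong M (solve (t ∷ []) [] (⟨e⟩ ⁻ ⊙ V 0 ⊙ ⟨e⟩) (V 0) refl)) , identityˡ x)
          , (λ (M , x) → (λ t → xor-comm (M t) false) , identityʳ x) }
      ; inverse =
          (λ (M , x) → (λ t → trans (cong (λ u → M (x · t · x ⁻¹) xor M u)
              (solve (x ∷ t ∷ []) [] (V 0 ⁻ ⁻ ⊙ V 1 ⊙ V 0 ⁻) (V 0 ⊙ V 1 ⊙ V 0 ⁻) refl)) (xor-same (M (x · t · x ⁻¹)))) , inverseˡ x)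
        , (λ (M , x) → (λ t → trans (cong (λ u → M t xor M u)
              (solve (x ∷ t ∷ []) [] (V 0 ⊙ (V 0 ⁻ ⊙ V 1 ⊙ V 0) ⊙ V 0 ⁻) (V 1) refl)) (xor-same (M t))) , inverseʳ x)
      ; ⁻¹-cong = λ { {_ , x} {_ , .x} (p , refl) → (λ t → p _) , refl } } }

  mirrorGenerator : Fin r → (W → Bool) × W
  mirrorGenerator i = (_== s i) , s i

  module Relations (i j : Fin r) where
    g : W
    g = s i · s j

    gⁿ : ℕ → W
    gⁿ = pow _·_ e g

    mⁿ : ℕ → (W → Bool) × W
    mⁿ = pow mirror ((λ _ → false) , e) (mirror (mirrorGenerator i) (mirrorGenerator j))

    -- The parity of the number of k < m with t = gᵏ sᵢ.
    parity : ℕ → W → Bool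
    parity zero    t = false
    parity (suc m) t = (t == s i) xor parity m (g ⁻¹ · t)

    proj₂-mⁿ : ∀ n → proj₂ (mⁿ n) ≡ gⁿ n
    proj₂-mⁿ zero    = refl
    proj₂-mⁿ (suc n) = cong (g ·_) (proj₂-mⁿ n)

    -- Since `s i` inverts `g`, the equation `t · g = gᵏ · s i` is equivalent to
    -- `g ⁻¹ · t = gᵏ · s i`.
    parity-shift : ∀ m t → parity m (t · g) ≡ parity m (g ⁻¹ · t)
    parity-shift zero    t = refl
    parity-shift (suc m) t = cong₂ _xor_
      (==-cong
        (λ p → trans (solve (t ∷ []) (σ i ∷ σ j ∷ [])
                   ((I 0 ⊙ I 1) ⁻ ⊙ V 0) ((I 0 ⊙ I 1) ⁻ ⊙ (V 0 ⊙ (I 0 ⊙ I 1)) ⊙ (I 0 ⊙ I 1) ⁻) refl)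
                 (trans (cong (λ u → g ⁻¹ · u · g ⁻¹) p)
                   (solve [] (σ i ∷ σ j ∷ []) ((I 0 ⊙ I 1) ⁻ ⊙ I 0 ⊙ (I 0 ⊙ I 1) ⁻) (I 0) refl)))
        (λ p → trans (solve (t ∷ []) (σ i ∷ σ j ∷ [])
                   (V 0 ⊙ (I 0 ⊙ I 1)) ((I 0 ⊙ I 1) ⊙ ((I 0 ⊙ I 1) ⁻ ⊙ V 0) ⊙ (I 0 ⊙ I 1)) refl)
                 (trans (cong (λ u → g · u · g) p)
                   (solve [] (σ i ∷ σ j ∷ []) ((I 0 ⊙ I 1) ⊙ I 0 ⊙ (I 0 ⊙ I 1)) (I 0) refl))))
      (trans (cong (parity m) (sym (assoc _ _ _))) (parity-shift m (g ⁻¹ · t)))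

    parity-+ : ∀ m n t → parity (m + n) (gⁿ m · t) ≡ parity m (gⁿ m · t) xor parity n t
    parity-+ zero    n t = cong (parity n) (identityˡ t)
    parity-+ (suc m) n t = trans
      (cong ((g · gⁿ m · t == s i) xor_) (trans (cong (parity (m + n)) shift)
        (trans (parity-+ m n t) (cong (λ u → parity m u xor parity n t) (sym shift)))))
      (sym (xor-assoc (g · gⁿ m · t == s i) _ _))
      where
      shift : g ⁻¹ · (g · gⁿ m · t) ≡ gⁿ m · t
      shift = solve (g ∷ gⁿ m ∷ t ∷ []) [] (V 0 ⁻ ⊙ (V 0 ⊙ V 1 ⊙ V 2)) (V 1 ⊙ V 2) refl

    -- One factor contributes the equations `t = s i` and `t = s i · s j · s i`, which are the cases
    -- `k = 0` and `k = 1`; so `n` factors account for all `k < 2n`.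
    proj₁-mⁿ : ∀ n t → proj₁ (mⁿ n) t ≡ parity (n + n) t
    proj₁-mⁿ zero    t = refl
    proj₁-mⁿ (suc n) t = trans (xor-assoc (t == s i) _ _) (trans
      (cong ((t == s i) xor_) (cong₂ _xor_
        (==-cong
          (λ p → trans (solve (t ∷ []) (σ i ∷ σ j ∷ []) ((I 0 ⊙ I 1) ⁻ ⊙ V 0) (I 1 ⊙ (I 0 ⁻ ⊙ V 0 ⊙ I 0) ⊙ I 0) refl)
                   (trans (cong (λ u → s j · u · s i) p) (solve [] (σ i ∷ σ j ∷ []) (I 1 ⊙ I 1 ⊙ I 0) (I 0) refl)))
          (λ p → trans (solve (t ∷ []) (σ i ∷ σ j ∷ []) (I 0 ⁻ ⊙ V 0 ⊙ I 0) (I 1 ⊙ ((I 0 ⊙ I 1) ⁻ ⊙ V 0) ⊙ I 0) refl)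
                   (trans (cong (λ u → s j · u · s i) p) (solve [] (σ i ∷ σ j ∷ []) (I 1 ⊙ I 0 ⊙ I 0) (I 1) refl))))
        (trans (proj₁-mⁿ n _) (parity-shift (n + n) (g ⁻¹ · t)))))
      (cong (λ k → parity k t) (sym (cong suc (+-suc n n)))))

    -- When `gⁿ = e` the elements `gᵏ · s i` with `k < 2n` run twice through the same list, so every
    -- `t` is met an even number of times.
    order-relation : ∀ n → gⁿ n ≡ e → mⁿ n ≈ₘ ((λ _ → false) , e)
    order-relation n gⁿ≡e = even , trans (proj₂-mⁿ n) gⁿ≡e
      where
      gⁿt≡t : ∀ t → gⁿ n · t ≡ t
      gⁿt≡t t = trans (cong (_· t) gⁿ≡e) (identityˡ t)

      even : ∀ t → proj₁ (mⁿ n) t ≡ false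
      even t = trans (proj₁-mⁿ n t) (trans (cong (parity (n + n)) (sym (gⁿt≡t t)))
        (trans (parity-+ n n t) (trans (cong (λ u → parity n u xor parity n t) (gⁿt≡t t)) (xor-same (parity n t)))))

  opaque
    mirrorHom : Σ (W → (W → Bool) × W) λ φ →
      (∀ x y → φ (x · y) ≈ₘ mirror (φ x) (φ y)) × (∀ i → φ (s i) ≈ₘ mirrorGenerator i)
    mirrorHom = presentation mirrorGroup mirrorGenerator
      λ i j n _ gⁿ≡e _ → Relations.order-relation i j n gⁿ≡e

  -- N w t says that the reflection t is a left inversion of w, i.e. ℓ (t · w) < ℓ w.
  N : W → W → Bool
  N w = proj₁ (proj₁ mirrorHom w)

  N-s : ∀ i t → N (s i) t ≡ (t == s i)
  N-s i = proj₁ (proj₂ (proj₂ mirrorHom) i)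

  -- The second component is an endomorphism of `W` that fixes the generators; hence the cocycle
  -- rule `N-·` conjugates by `x` itself.
  mirrorHom-section : ∀ w → proj₂ (proj₁ mirrorHom w) ≡ w
  mirrorHom-section w with generated w
  ... | a , refl = go a
    where
    φ₂ : W → W
    φ₂ x = proj₂ (proj₁ mirrorHom x)

    φ₂-homo : ∀ x y → φ₂ (x · y) ≡ φ₂ x · φ₂ y
    φ₂-homo x y = proj₂ (proj₁ (proj₂ mirrorHom) x y)

    go : ∀ a → φ₂ (prod a) ≡ prod a
    go []      = identityˡ-unique (φ₂ e) (φ₂ e) (trans (sym (φ₂-homo e e)) (cong φ₂ (identityˡ e)))
    go (i ∷ a) = trans (φ₂-homo (s i) (prod a)) (cong₂ _·_ (proj₂ (proj₂ (proj₂ mirrorHom) i)) (go a))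

  N-· : ∀ x y t → N (x · y) t ≡ N x t xor N y (x ⁻¹ · t · x)
  N-· x y t = trans (proj₁ (proj₁ (proj₂ mirrorHom) x y) t)
    (cong (λ z → N x t xor N y (z ⁻¹ · t · z)) (mirrorHom-section x))

  N-e : ∀ t → N e t ≡ false
  N-e t = begin
    N e t                           ≡⟨ cong (λ x → N x t) (sym (identityˡ e)) ⟩
    N (e · e) t                     ≡⟨ N-· e e t ⟩
    N e t xor N e (e ⁻¹ · t · e)    ≡⟨ cong (λ u → N e t xor N e u) (solve (t ∷ []) [] (⟨e⟩ ⁻ ⊙ V 0 ⊙ ⟨e⟩) (V 0) refl) ⟩
    N e t xor N e t                 ≡⟨ xor-same (N e t) ⟩
    false                           ∎
    where open ≡-Reasoning

  N-⁻¹ : ∀ x t → N (x ⁻¹) t ≡ N x (x · t · x ⁻¹)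
  N-⁻¹ x t = sym (xor-cancel (begin
    N x (x · t · x ⁻¹) xor N (x ⁻¹) t
      ≡⟨ cong (λ u → N x (x · t · x ⁻¹) xor N (x ⁻¹) u) (solve (x ∷ t ∷ []) [] (V 1) (V 0 ⁻ ⊙ (V 0 ⊙ V 1 ⊙ V 0 ⁻) ⊙ V 0) refl) ⟩
    N x (x · t · x ⁻¹) xor N (x ⁻¹) (x ⁻¹ · (x · t · x ⁻¹) · x)
      ≡⟨ sym (N-· x (x ⁻¹) _) ⟩
    N (x · x ⁻¹) (x · t · x ⁻¹)
      ≡⟨ cong (λ u → N u (x · t · x ⁻¹)) (inverseʳ x) ⟩
    N e (x · t · x ⁻¹)
      ≡⟨ N-e _ ⟩
    false ∎))
    where open ≡-Reasoning

  N-ss : ∀ i → N (s i) (s i) ≡ true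
  N-ss i = trans (N-s i (s i)) (==-refl (s i))

  N-s· : ∀ i w → N (s i · w) (s i) ≡ not (N w (s i))
  N-s· i w = trans (N-· (s i) w (s i)) (cong₂ _xor_ (N-ss i) (cong (N w) (solve [] (σ i ∷ []) (I 0 ⁻ ⊙ I 0 ⊙ I 0) (I 0) refl)))

  -- Reflections, strong exchange and reduced words.

  refl-s : ∀ i → IsReflection (s i)
  refl-s i = e , i , solve [] (σ i ∷ []) (I 0) (⟨e⟩ ⊙ I 0 ⊙ ⟨e⟩ ⁻) refl

  refl-conj : ∀ x {t} → IsReflection t → IsReflection (x · t · x ⁻¹)
  refl-conj x (w , i , refl) = x · w , i ,
    solve (x ∷ w ∷ []) (σ i ∷ []) (V 0 ⊙ (V 1 ⊙ I 0 ⊙ V 1 ⁻) ⊙ V 0 ⁻) ((V 0 ⊙ V 1) ⊙ I 0 ⊙ (V 0 ⊙ V 1) ⁻) refl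

  refl-conj⁻¹ : ∀ x {t} → IsReflection t → IsReflection (x ⁻¹ · t · x)
  refl-conj⁻¹ x {t} p = subst (λ y → IsReflection (x ⁻¹ · t · y)) (⁻¹-involutive x) (refl-conj (x ⁻¹) p)

  refl-involution : ∀ {t} → IsReflection t → t · t ≡ e
  refl-involution (w , i , refl) = solve (w ∷ []) (σ i ∷ []) ((V 0 ⊙ I 0 ⊙ V 0 ⁻) ⊙ (V 0 ⊙ I 0 ⊙ V 0 ⁻)) ⟨e⟩ refl

  τ : ∀ {t} → IsReflection t → Involution
  τ {t} p = t , refl-involution p

  -- Expanding along `t = w · s i · w ⁻¹`, the contributions of `w` and `w ⁻¹` are equal and cancel,
  -- which leaves `N (s i) (s i)`.
  N-reflection : ∀ {t} → IsReflection t → N t t ≡ true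
  N-reflection (w , i , refl) = begin
    N (w · s i · w ⁻¹) t
      ≡⟨ N-· (w · s i) (w ⁻¹) t ⟩
    N (w · s i) t xor N (w ⁻¹) ((w · s i) ⁻¹ · t · (w · s i))
      ≡⟨ cong₂ _xor_ (N-· w (s i) t) (trans (cong (N (w ⁻¹)) c₁) (N-⁻¹ w (s i))) ⟩
    (N w t xor N (s i) (w ⁻¹ · t · w)) xor N w t
      ≡⟨ cong (λ u → (N w t xor N (s i) u) xor N w t) c₂ ⟩
    (N w t xor N (s i) (s i)) xor N w t
      ≡⟨ cong (λ b → (N w t xor b) xor N w t) (N-ss i) ⟩
    (N w t xor true) xor N w t
      ≡⟨ lemma (N w t) ⟩
    true ∎
    where
    open ≡-Reasoning
    t = w · s i · w ⁻¹
    c₁ = solve (w ∷ []) (σ i ∷ []) ((V 0 ⊙ I 0) ⁻ ⊙ (V 0 ⊙ I 0 ⊙ V 0 ⁻) ⊙ (V 0 ⊙ I 0)) (I 0) refl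
    c₂ = solve (w ∷ []) (σ i ∷ []) (V 0 ⁻ ⊙ (V 0 ⊙ I 0 ⊙ V 0 ⁻) ⊙ V 0) (I 0) refl
    lemma : ∀ b → (b xor true) xor b ≡ true
    lemma true  = refl
    lemma false = refl

  N-t· : ∀ {t} → IsReflection t → ∀ w → N (t · w) t ≡ not (N w t)
  N-t· {t} p w = trans (N-· t w t) (cong₂ _xor_ (N-reflection p) (cong (N w) (solve [] (τ p ∷ []) (I 0 ⁻ ⊙ I 0 ⊙ I 0) (I 0) refl)))

  -- Strong exchange. Either `t` is the first letter, which is then deleted, or the cocycle rule
  -- hands the inversion, conjugated by the first letter, to the rest of the word.
  exchange : ∀ a {t} → N (prod a) t ≡ true → ∃[ b ] (b ⊆ a × length a ≡ suc (length b) × prod b ≡ t · prod a)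
  exchange [] {t} p = contradiction (trans (sym p) (N-e t)) λ ()
  exchange (i ∷ a) {t} p with t ≟ s i
  ... | yes refl = a , i ∷ʳ ⊆-refl , refl , solve (prod a ∷ []) (σ i ∷ []) (V 0) (I 0 ⊙ (I 0 ⊙ V 0)) refl
  ... | no t≢s with exchange a {s i ⁻¹ · t · s i}
        (trans (sym (trans (N-· (s i) (prod a) t) (cong (_xor N (prod a) (s i ⁻¹ · t · s i)) (trans (N-s i t) (==-false t≢s))))) p)
  ...   | b , b⊆a , len , eq = i ∷ b , refl ∷ b⊆a , cong suc len ,
          trans (cong (s i ·_) eq) (solve (t ∷ prod a ∷ []) (σ i ∷ []) (I 0 ⊙ ((I 0 ⁻ ⊙ V 0 ⊙ I 0) ⊙ V 1)) (V 0 ⊙ (I 0 ⊙ V 1)) refl)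

  -- Reducedness in terms of left descents, suited to induction on the word. `Reduced-minimal` and
  -- `minimal⇒Reduced` show that it agrees with minimality of the length.
  data Reduced : List (Fin r) → Set where
    []  : Reduced []
    _∷_ : ∀ {i a} → N (prod a) (s i) ≡ false → Reduced a → Reduced (i ∷ a)

  Reduced-minimal : ∀ {a} → Reduced a → ∀ b → prod b ≡ prod a → length a ≤ length b
  Reduced-minimal [] b eq = z≤n
  Reduced-minimal {i ∷ a} (p ∷ ra) b eq
    with exchange b {s i} (trans (cong (λ w → N w (s i)) eq) (trans (N-s· i (prod a)) (cong not p)))
  ... | b′ , _ , len , eq′ rewrite len = s≤s (Reduced-minimal ra b′ (trans eq′ (trans (cong (s i ·_) eq)
          (solve (prod a ∷ []) (σ i ∷ []) (I 0 ⊙ (I 0 ⊙ V 0)) (V 0) refl))))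

  minimal⇒Reduced : ∀ a → (∀ b → prod b ≡ prod a → length a ≤ length b) → Reduced a
  minimal⇒Reduced [] _ = []
  minimal⇒Reduced (i ∷ a) m with N (prod a) (s i) in eq
  ... | false = eq ∷ minimal⇒Reduced a (λ b p → ≤-pred (m (i ∷ b) (cong (s i ·_) p)))
  ... | true with exchange a {s i} eq
  ...   | b , _ , len , p = contradiction (m b p) (<⇒≱ (≤-trans (n≤1+n _) (≤-reflexive (cong suc (sym len)))))

  -- The deletion property. That the result is a subword is used later to reduce a word without
  -- introducing new letters.
  reduce : ∀ a → ∃[ b ] (b ⊆ a × prod b ≡ prod a × Reduced b)
  reduce a = go (length a) a ≤-refl
    where
    -- The recursion is on the bound `n`, since the word left after an exchange is shorter but not
    -- structurally smaller.
    go : ∀ n a → length a ≤ n → ∃[ b ] (b ⊆ a × prod b ≡ prod a × Reduced b)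
    go _ [] _ = [] , [] , refl , []
    go (suc n) (i ∷ a) (s≤s le) with go n a le
    ... | b , b⊆a , eq , rb with N (prod b) (s i) in eqN
    ...   | false = i ∷ b , refl ∷ b⊆a , cong (s i ·_) eq , eqN ∷ rb
    ...   | true with exchange b {s i} eqN
    ...     | b′ , b′⊆b , len , eq′ with go n b′ (≤-trans (n≤1+n _) (≤-trans (≤-reflexive (sym len)) (≤-trans (length-mono-≤ b⊆a) le)))
    ...       | b″ , b″⊆b′ , eq″ , rb″ = b″ , i ∷ʳ ⊆-trans b″⊆b′ (⊆-trans b′⊆b b⊆a) , trans eq″ (trans eq′ (cong (s i ·_) eq)) , rb″

  opaque
    reducedWord : ∀ w → ∃[ a ] (prod a ≡ w × Reduced a)
    reducedWord w with generated w
    ... | a , eq with reduce a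
    ...   | b , _ , eq′ , rb = b , trans eq′ eq , rb

  ℓ : W → ℕ
  ℓ w = length (proj₁ (reducedWord w))

  ℓ-minimal : ∀ a → ℓ (prod a) ≤ length a
  ℓ-minimal a with reducedWord (prod a)
  ... | b , eq , rb = Reduced-minimal rb a (sym eq)

  LenS-ℓ : ∀ w → LenS w (ℓ w)
  LenS-ℓ w with reducedWord w
  ... | b , eq , rb = (b , refl , eq) , λ a p → Reduced-minimal rb a (trans p (sym eq))

  LenS-unique : ∀ {w m n} → LenS w m → LenS w n → m ≡ n
  LenS-unique ((a , refl , p) , ma) ((b , refl , q) , mb) = ≤-antisym (ma b q) (mb a p)

  LenS⇒ℓ : ∀ {w n} → LenS w n → ℓ w ≡ n
  LenS⇒ℓ {w} = LenS-unique (LenS-ℓ w)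

  ℓ≡⇒LenS : ∀ {w n} → ℓ w ≡ n → LenS w n
  ℓ≡⇒LenS {w} refl = LenS-ℓ w

  Reduced⇒ℓ : ∀ {a} → Reduced a → ℓ (prod a) ≡ length a
  Reduced⇒ℓ {a} ra = LenS⇒ℓ ((a , refl , refl) , Reduced-minimal ra)

  ℓ⇒Reduced : ∀ a → ℓ (prod a) ≡ length a → Reduced a
  ℓ⇒Reduced a eq = minimal⇒Reduced a λ b p → ≤-trans (≤-reflexive (sym eq)) (≤-trans (≤-reflexive (cong ℓ (sym p))) (ℓ-minimal b))

  prod-++ : ∀ a b → prod (a ++ b) ≡ prod a · prod b
  prod-++ []      b = sym (identityˡ _)
  prod-++ (i ∷ a) b = trans (cong (s i ·_) (prod-++ a b)) (sym (assoc _ _ _))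

  ℓ-·prod : ∀ w a → ℓ (w · prod a) ≤ ℓ w + length a
  ℓ-·prod w a with reducedWord w
  ... | b , refl , rb = ≤-trans (≤-reflexive (cong ℓ (sym (prod-++ b a)))) (≤-trans (ℓ-minimal (b ++ a)) (≤-reflexive (length-++ b)))

  N-true⇒ℓ< : ∀ {w t} → N w t ≡ true → ℓ (t · w) < ℓ w
  N-true⇒ℓ< {w} {t} p with reducedWord w
  ... | a , refl , ra with exchange a p
  ...   | b , _ , len , eq = ≤-trans (s≤s (≤-trans (≤-reflexive (cong ℓ (sym eq))) (ℓ-minimal b))) (≤-reflexive (sym len))

  N-false⇒ℓ< : ∀ {w t} → IsReflection t → N w t ≡ false → ℓ w < ℓ (t · w)
  N-false⇒ℓ< {w} {t} rt p = subst (λ x → ℓ x < ℓ (t · w))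
    (solve (w ∷ []) (τ rt ∷ []) (I 0 ⊙ (I 0 ⊙ V 0)) (V 0) refl)
    (N-true⇒ℓ< (trans (N-t· rt w) (cong not p)))

  -- R y t says that t is a right inversion of y, i.e. ℓ (y · t) < ℓ y.
  R : W → W → Bool
  R y t = N (y ⁻¹) t

  private
    right-as-left : ∀ y t → (y · t · y ⁻¹) · y ≡ y · t
    right-as-left y t = solve (y ∷ t ∷ []) [] ((V 0 ⊙ V 1 ⊙ V 0 ⁻) ⊙ V 0) (V 0 ⊙ V 1) refl

  R-true⇒ℓ< : ∀ {y t} → R y t ≡ true → ℓ (y · t) < ℓ y
  R-true⇒ℓ< {y} {t} p = subst (λ x → ℓ x < ℓ y) (right-as-left y t) (N-true⇒ℓ< (trans (sym (N-⁻¹ y t)) p))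

  R-false⇒ℓ< : ∀ {y t} → IsReflection t → R y t ≡ false → ℓ y < ℓ (y · t)
  R-false⇒ℓ< {y} {t} rt p = subst (λ x → ℓ y < ℓ x) (right-as-left y t) (N-false⇒ℓ< (refl-conj y rt) (trans (sym (N-⁻¹ y t)) p))

  ℓ<⇒R-false : ∀ {y t} → ℓ y ≤ ℓ (y · t) → R y t ≡ false
  ℓ<⇒R-false {y} {t} lt with R y t in eq
  ... | false = refl
  ... | true  = contradiction lt (<⇒≱ (R-true⇒ℓ< eq))

  R-· : ∀ y p t → R (y · p) t ≡ R p t xor R y (p · t · p ⁻¹)
  R-· y p t = trans (cong (λ z → N z t) (⁻¹-anti-homo-∙ y p))
    (trans (N-· (p ⁻¹) (y ⁻¹) t) (cong (λ z → N (p ⁻¹) t xor N (y ⁻¹) (z · t · p ⁻¹)) (⁻¹-involutive p)))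

  R-·t : ∀ {t} → IsReflection t → ∀ y → R (y · t) t ≡ not (R y t)
  R-·t {t} rt y = trans (R-· y t t) (cong₂ _xor_
    (trans (cong (λ z → N z t) (solve [] (τ rt ∷ []) (I 0 ⁻) (I 0) refl)) (N-reflection rt))
    (cong (R y) (solve [] (τ rt ∷ []) (I 0 ⊙ I 0 ⊙ I 0 ⁻) (I 0) refl)))

  -- Absolute length

  -- The cocycle rule leaves `N t t` and the test `t = s i`, and the latter fails since `g` is not
  -- `e`.
  N-factor : ∀ {g t} i → IsReflection t → g ≡ t · s i → g ≢ e → N g t ≡ true
  N-factor {g} {t} i rt refl g≢e = trans (N-· t (s i) t) (cong₂ _xor_ (N-reflection rt)
    (trans (cong (N (s i)) (solve [] (τ rt ∷ []) (I 0 ⁻ ⊙ I 0 ⊙ I 0) (I 0) refl))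
      (trans (N-s i t) (==-false λ { refl → g≢e (s-involution i) }))))

  -- Both `τ₀` and `τ₀ · g` are involutions, so conjugation by `τ₀` inverts the rotation `g`.
  refl-commute : ∀ {τ₀ g} → IsReflection τ₀ → IsReflection (τ₀ · g) → g ⁻¹ · τ₀ ≡ τ₀ · g
  refl-commute {τ₀} {g} p q = trans (solve (g ∷ []) (τ p ∷ []) (V 0 ⁻ ⊙ I 0) ((I 0 ⊙ V 0) ⁻) refl)
    (solve [] (τ q ∷ []) (I 0 ⁻) (I 0) refl)

  -- The rotation g = t′t has an inversion in the dihedral group ⟨t , t′⟩. This holds when t is
  -- simple; conjugation by a simple reflection transports inversions unless that
  -- reflection itself lies in the dihedral group, in which case it yields an inversion directly.
  rotation-inversion : ∀ {g t} → IsReflection t → IsReflection (g · t) → g ≢ e →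
    ∃[ x ] (IsReflection x × IsReflection (x · g) × N g x ≡ true)
  rotation-inversion (w , i , refl) with generated w
  ... | a , refl = go a
    where
    go : ∀ a {g} → let t = prod a · s i · prod a ⁻¹ in
         IsReflection (g · t) → g ≢ e → ∃[ x ] (IsReflection x × IsReflection (x · g) × N g x ≡ true)
    go [] {g} rgt g≢e = g · s i , rgt′ ,
        rgt′g ,
        N-factor i rgt′ (solve (g ∷ []) (σ i ∷ []) (V 0) (V 0 ⊙ I 0 ⊙ I 0) refl) g≢e
      where
      rgt′ : IsReflection (g · s i)
      rgt′ = subst IsReflection (solve (g ∷ []) (σ i ∷ []) (V 0 ⊙ (⟨e⟩ ⊙ I 0 ⊙ ⟨e⟩ ⁻)) (V 0 ⊙ I 0) refl) rgt
      rgt′g : IsReflection (g · s i · g)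
      rgt′g = subst IsReflection
        (trans (solve (g ∷ []) (σ i ∷ []) (I 0) ((V 0 ⊙ I 0) ⁻ ⊙ V 0) refl)
          (cong (_· g) (solve [] (τ rgt′ ∷ []) (I 0 ⁻) (I 0) refl)))
        (refl-s i)
    go (j ∷ a) {g} rgt g≢e with go a {s j · g · s j} rgt₁ (λ p → g≢e (trans
          (solve (g ∷ []) (σ j ∷ []) (V 0) (I 0 ⊙ (I 0 ⊙ V 0 ⊙ I 0) ⊙ I 0) refl)
          (trans (cong (λ z → s j · z · s j) p) (solve [] (σ j ∷ []) (I 0 ⊙ ⟨e⟩ ⊙ I 0) ⟨e⟩ refl))))
      where
      rgt₁ : IsReflection (s j · g · s j · (prod a · s i · prod a ⁻¹))
      rgt₁ = subst IsReflection (solve (g ∷ prod a ∷ []) (σ j ∷ σ i ∷ [])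
        (I 0 ⊙ (V 0 ⊙ ((I 0 ⊙ V 1) ⊙ I 1 ⊙ (I 0 ⊙ V 1) ⁻)) ⊙ I 0 ⁻)
        (I 0 ⊙ V 0 ⊙ I 0 ⊙ (V 1 ⊙ I 1 ⊙ V 1 ⁻)) refl) (refl-conj (s j) rgt)
    ... | x₁ , rx₁ , rxg₁ , N₁ = result
      where
      x : W
      x = s j · x₁ · s j ⁻¹

      rx : IsReflection x
      rx = refl-conj (s j) rx₁

      rxg : IsReflection (x · g)
      rxg = subst IsReflection (solve (x₁ ∷ g ∷ []) (σ j ∷ []) (I 0 ⊙ (V 0 ⊙ (I 0 ⊙ V 1 ⊙ I 0)) ⊙ I 0 ⁻) (I 0 ⊙ V 0 ⊙ I 0 ⁻ ⊙ V 1) refl)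
        (refl-conj (s j) rxg₁)

      rgx : IsReflection (g · x)
      rgx = subst IsReflection (solve (g ∷ x ∷ []) [] (V 0 ⊙ (V 1 ⊙ V 0) ⊙ V 0 ⁻) (V 0 ⊙ V 1) refl) (refl-conj g rxg)

      gxg≡x : g · (x · g) ≡ x
      gxg≡x = trans (cong (g ·_) (sym (refl-commute rx rxg))) (solve (g ∷ x ∷ []) [] (V 0 ⊙ (V 0 ⁻ ⊙ V 1)) (V 1) refl)

      transported : N (s j · g · s j) x₁ ≡ (N (s j) x₁ xor N g x) xor N (s j) (g ⁻¹ · x · g)
      transported = trans (N-· (s j · g) (s j) x₁) (cong₂ _xor_
        (trans (N-· (s j) g x₁) (cong (λ z → N (s j) x₁ xor N g z)
          (solve (x₁ ∷ []) (σ j ∷ []) (I 0 ⁻ ⊙ V 0 ⊙ I 0) (I 0 ⊙ V 0 ⊙ I 0 ⁻) refl)))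
        (cong (N (s j)) (solve (x₁ ∷ g ∷ []) (σ j ∷ []) ((I 0 ⊙ V 1) ⁻ ⊙ V 0 ⊙ (I 0 ⊙ V 1)) (V 1 ⁻ ⊙ (I 0 ⊙ V 0 ⊙ I 0 ⁻) ⊙ V 1) refl)))

      -- The two extra terms of `transported` vanish unless `x₁` or `g ⁻¹ · x · g` is `s j`. In
      -- these exceptional cases `g` is a reflection times `s j`, namely `g · x` or `x · g`, and
      -- `N-factor` applies.
      result : ∃[ x ] (IsReflection x × IsReflection (x · g) × N g x ≡ true)
      result with x₁ ≟ s j | (g ⁻¹ · x · g) ≟ s j
      ... | yes x₁≡s | _ = g · x ,
            rgx ,
            subst IsReflection (trans (sym gxg≡x) (sym (assoc _ _ _))) rx ,
            N-factor j rgx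
              (trans (solve (g ∷ []) (σ j ∷ []) (V 0) (V 0 ⊙ (I 0 ⊙ I 0 ⊙ I 0 ⁻) ⊙ I 0) refl) (cong (λ z → g · (s j · z · s j ⁻¹) · s j) (sym x₁≡s))) g≢e
      ... | no _ | yes q = x · g , rxg ,
            subst IsReflection (trans (sym q) (cong (_· g) (refl-commute rx rxg))) (refl-s j) ,
            N-factor j rxg (trans (solve (x ∷ g ∷ []) [] (V 1) (V 1 ⊙ V 0 ⁻ ⊙ V 0 ) refl)
              (trans (solve (g ∷ []) (τ rx ∷ []) (V 0 ⊙ I 0 ⁻ ⊙ I 0) ((I 0 ⊙ V 0) ⁻ ⁻ ⁻ ⊙ ((I 0 ⊙ V 0) ⊙ V 0)) refl)
                (cong₂ _·_ (trans (cong (λ z → z ⁻¹ ⁻¹) (solve [] (τ rxg ∷ []) (I 0 ⁻) (I 0) refl)) (⁻¹-involutive _))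
                  (trans (cong (_· g) (sym (refl-commute rx rxg))) q)))) g≢e
      ... | no x₁≢s | no q = x , rx , rxg , trans (sym (trans transported
            (trans (cong₂ (λ b b′ → (b xor N g x) xor b′) (trans (N-s j x₁) (==-false x₁≢s)) (trans (N-s j _) (==-false q)))
              (xor-comm (N g x) false)))) N₁

  -- With `g = t′ · t` one has `t′ · y = g · (t · y)`. By the cocycle rule an inversion `x` of `g`
  -- is an inversion of `t′ · y`, or else `g ⁻¹ · x · g` is one of `t · y`. That reflection leads
  -- from one side of the peak to a lower vertex, which the other side also reaches by a reflection.
  lower-peak : ∀ {y t t′} → IsReflection t → IsReflection t′ → t ≢ t′ → N y t ≡ true → N y t′ ≡ true →
    ∃[ x ] ∃[ x′ ] (IsReflection x × IsReflection x′ × x · (t · y) ≡ x′ · (t′ · y) × ℓ (x · (t · y)) < ℓ y)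
  lower-peak {y} {t} {t′} rt rt′ t≢t′ Nt Nt′
    with rotation-inversion {t′ · t} rt (subst IsReflection (solve (t′ ∷ []) (τ rt ∷ []) (V 0) (V 0 ⊙ I 0 ⊙ I 0) refl) rt′)
           (λ p → t≢t′ (sym (trans (solve (t′ ∷ []) (τ rt ∷ []) (V 0) (V 0 ⊙ I 0 ⊙ I 0) refl) (trans (cong (_· t) p) (identityˡ t)))))
  ... | x , rx , rxg , Nx with N (t′ · y) x in eq
  ...   | true = x · (t′ · t) , x , rxg , rx , same ,
          ≤-<-trans (≤-reflexive (cong ℓ same)) (<-trans (N-true⇒ℓ< eq) (N-true⇒ℓ< Nt′))
        where
        same : x · (t′ · t) · (t · y) ≡ x · (t′ · y)
        same = solve (x ∷ t′ ∷ y ∷ []) (τ rt ∷ []) (V 0 ⊙ (V 1 ⊙ I 0) ⊙ (I 0 ⊙ V 2)) (V 0 ⊙ (V 1 ⊙ V 2)) refl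
  ...   | false = x₁ , g ⁻¹ · x , refl-conj⁻¹ g rx , subst IsReflection (sym (refl-commute rx rxg)) rxg ,
          solve (x ∷ y ∷ []) (τ rt ∷ τ rt′ ∷ []) (((I 1 ⊙ I 0) ⁻ ⊙ V 0 ⊙ (I 1 ⊙ I 0)) ⊙ (I 0 ⊙ V 1)) ((I 1 ⊙ I 0) ⁻ ⊙ V 0 ⊙ (I 1 ⊙ V 1)) refl ,
          <-trans (N-true⇒ℓ< N₁) (N-true⇒ℓ< Nt)
        where
        g = t′ · t
        x₁ = g ⁻¹ · x · g
        N₁ : N (t · y) x₁ ≡ true
        N₁ with N (t · y) x₁ in eq₁
        ... | true  = refl
        ... | false = contradiction (begin
          true                          ≡⟨ sym Nx ⟩
          N g x                         ≡⟨ xor-comm false (N g x) ⟩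
          N g x xor false               ≡⟨ cong (N g x xor_) (sym eq₁) ⟩
          N g x xor N (t · y) x₁        ≡⟨ sym (N-· g (t · y) x) ⟩
          N (g · (t · y)) x             ≡⟨ cong (λ z → N z x) (solve (t′ ∷ y ∷ []) (τ rt ∷ []) ((V 0 ⊙ I 0) ⊙ (I 0 ⊙ V 1)) (V 0 ⊙ V 1) refl) ⟩
          N (t′ · y) x                  ≡⟨ eq ⟩
          false                         ∎) λ ()
          where open ≡-Reasoning

  data Ascent : W → ℕ → Set where
    start : Ascent e 0
    step  : ∀ {x k t} → Ascent x k → IsReflection t → N x t ≡ false → Ascent (t · x) (suc k)

  -- Peaks are removed from a path of reflections by lower-peak, which lowers the
  -- vertex in the middle, so that a path starting at e becomes increasing.
  extend : ∀ {x k t} → Acc _<_ (ℓ x) → Ascent x k → IsReflection t → ∃[ m ] (m ≤ suc k × Ascent (t · x) m)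
  extend {x} {k} {t} ac p rt with N x t in eq
  ... | false = suc k , ≤-refl , step p rt eq
  extend {t = t} ac start rt | true = contradiction (trans (sym eq) (N-e t)) λ ()
  extend {t = t} (acc rec) (step {x} {k} {t₀} p rt₀ N₀) rt | true with t₀ ≟ t
  ... | yes refl = k , ≤-trans (n≤1+n k) (n≤1+n (suc k)) , subst (λ z → Ascent z k) (solve (x ∷ []) (τ rt ∷ []) (V 0) (I 0 ⊙ (I 0 ⊙ V 0)) refl) p
  -- The peak `t₀ · x` gives way to `y · x`. The two recursive calls start from `x` and from
  -- `y · x`, both shorter than the peak, and two steps replace two.
  ... | no t₀≢t with lower-peak rt₀ rt t₀≢t (trans (N-t· rt₀ x) (cong not N₀)) eq
  ...   | y , y′ , ry , ry′ , same , lt with extend (rec (N-false⇒ℓ< rt₀ N₀)) p ry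
  ...     | m , m≤ , q with extend (rec (subst (λ z → ℓ (y · z) < ℓ (t₀ · x)) (solve (x ∷ []) (τ rt₀ ∷ []) (I 0 ⊙ (I 0 ⊙ V 0)) (V 0) refl) lt)) q ry′
  ...       | m′ , m′≤ , q′ = m′ , ≤-trans m′≤ (s≤s m≤) , subst (λ z → Ascent z m′)
              (trans (cong (λ z → y′ · (y · z)) (solve (x ∷ []) (τ rt₀ ∷ []) (V 0) (I 0 ⊙ (I 0 ⊙ V 0)) refl))
                (trans (cong (y′ ·_) same) (solve (t · (t₀ · x) ∷ []) (τ ry′ ∷ []) (I 0 ⊙ (I 0 ⊙ V 0)) (V 0) refl))) q′

  ascent : ∀ {ts} → All IsReflection ts → ∃[ k ] (k ≤ length ts × Ascent (prodW ts) k)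
  ascent []        = 0 , z≤n , start
  ascent (rt ∷ rs) with ascent rs
  ... | k , k≤ , p with extend (<-wellFounded _) p rt
  ...   | m , m≤ , q = m , ≤-trans m≤ (s≤s k≤) , q

  delete-letters : ∀ {w k} → Ascent w k → ∀ a → prod a ≡ w → ∃[ b ] (b ⊆ a × length a ≡ k + length b × prod b ≡ e)
  delete-letters start a eq = a , ⊆-refl , refl , eq
  delete-letters (step {x} {k} {t} p rt Nx) a eq with exchange a {t} (trans (cong (λ z → N z t) eq) (trans (N-t· rt x) (cong not Nx)))
  ... | b , b⊆a , len , eq′ with delete-letters p b (trans eq′ (trans (cong (t ·_) eq) (solve (x ∷ []) (τ rt ∷ []) (I 0 ⊙ (I 0 ⊙ V 0)) (V 0) refl)))
  ...   | b′ , b′⊆b , len′ , eq″ = b′ , ⊆-trans b′⊆b b⊆a , trans len (cong suc len′) , eq″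

  -- A reduced subword with product `s i` consists of a single letter, and `s` is injective.
  s∉parabolic : ∀ {i a} → All (i ≢_) a → prod a ≢ s i
  s∉parabolic {i} {a} i∉a eq with reduce a
  ... | b , b⊆a , eqb , rb = absurd b b⊆a eqb rb
    where
    absurd : ∀ b → b ⊆ a → prod b ≡ prod a → Reduced b → ⊥
    absurd [] _ eqb _ = s-nontrivial i (sym (trans eqb eq))
    absurd (j ∷ []) b⊆a eqb _ = All.lookup i∉a (⊆-lookup b⊆a (here refl)) (s-injective (sym (trans (sym (identityʳ (s j))) (trans eqb eq))))
    absurd (j ∷ j′ ∷ b) _ eqb rb = contradiction (Reduced-minimal rb (i ∷ []) (trans (identityʳ _) (sym (trans eqb eq)))) λ { (s≤s ()) }

  prod-unique≢e : ∀ {i a} → Unique (i ∷ a) → prod (i ∷ a) ≢ e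
  prod-unique≢e {i} {a} (i∉a ∷ _) eq = s∉parabolic i∉a (trans
    (solve (prod a ∷ []) (σ i ∷ []) (V 0) (I 0 ⊙ (I 0 ⊙ V 0)) refl) (trans (cong (s i ·_) eq) (identityʳ _)))

  prodW-simple : ∀ a → prodW (map s a) ≡ prod a
  prodW-simple []      = refl
  prodW-simple (i ∷ a) = cong (s i ·_) (prodW-simple a)

  simple-reflections : ∀ a → All IsReflection (map s a)
  simple-reflections []      = []
  simple-reflections (i ∷ a) = refl-s i ∷ simple-reflections a

  -- An ascent with `k` steps deletes `k` letters and leaves a word for `e`. A word without repeated
  -- letters represents `e` only if it is empty, so `k` is the full length.
  LenT-unique-word : ∀ {a} → Unique a → LenT (prod a) (length a)
  LenT-unique-word {a} ua = (map s a , simple-reflections a , length-map s a , prodW-simple a) , lower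
    where
    lower : ∀ ts → All IsReflection ts → prodW ts ≡ prod a → length a ≤ length ts
    lower ts rts eq with ascent rts
    ... | k , k≤ , p with delete-letters p a (sym eq)
    ...   | [] , _ , len , _ = ≤-trans (≤-reflexive (trans len (+-identityʳ k))) k≤
    ...   | i ∷ b , b⊆a , _ , eq′ = contradiction eq′ (prod-unique≢e (AllPairs-⊆ b⊆a ua))

  -- Chains in the absolute and Bruhat orders

  prodW-++ : ∀ xs ys → prodW (xs ++ ys) ≡ prodW xs · prodW ys
  prodW-++ []       ys = sym (identityˡ _)
  prodW-++ (x ∷ xs) ys = trans (cong (x ·_) (prodW-++ xs ys)) (sym (assoc _ _ _))

  LenT-unique : ∀ {w m n} → LenT w m → LenT w n → m ≡ n
  LenT-unique ((ts , r₁ , refl , p) , m₁) ((us , r₂ , refl , q) , m₂) = ≤-antisym (m₁ us r₂ q) (m₂ ts r₁ p)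

  LenT-e : LenT e 0
  LenT-e = ([] , [] , refl , refl) , λ _ _ _ → z≤n

  LenT-0 : ∀ {w} → LenT w 0 → w ≡ e
  LenT-0 (([] , _ , _ , p) , _) = sym p

  record TReduced (ts : List W) : Set where
    constructor treduced
    field
      reflections : All IsReflection ts
      shortest    : ∀ us → All IsReflection us → prodW us ≡ prodW ts → length ts ≤ length us

  open TReduced

  TReduced⇒LenT : ∀ {ts} → TReduced ts → LenT (prodW ts) (length ts)
  TReduced⇒LenT {ts} (treduced rts m) = (ts , rts , refl , refl) , m

  TReduced-++ˡ : ∀ xs {ys} → TReduced (xs ++ ys) → TReduced xs
  TReduced-++ˡ xs {ys} (treduced rts m) = treduced (All-++⁻ˡ xs rts) λ us rus eq →
    +-cancelʳ-≤ (length ys) _ _ (begin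
      length xs + length ys ≡⟨ sym (length-++ xs) ⟩
      length (xs ++ ys)     ≤⟨ m (us ++ ys) (All-++⁺ rus (All-++⁻ʳ xs rts))
                                 (trans (prodW-++ us ys) (trans (cong (_· prodW ys) eq) (sym (prodW-++ xs ys)))) ⟩
      length (us ++ ys)     ≡⟨ length-++ us ⟩
      length us + length ys ∎)
    where open ≤-Reasoning

  TReduced-++ʳ : ∀ xs {ys} → TReduced (xs ++ ys) → TReduced ys
  TReduced-++ʳ xs {ys} (treduced rts m) = treduced (All-++⁻ʳ xs rts) λ us rus eq →
    +-cancelˡ-≤ (length xs) _ _ (begin
      length xs + length ys ≡⟨ sym (length-++ xs) ⟩
      length (xs ++ ys)     ≤⟨ m (xs ++ us) (All-++⁺ (All-++⁻ˡ xs rts) rus)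
                                 (trans (prodW-++ xs us) (trans (cong (prodW xs ·_) eq) (sym (prodW-++ xs ys)))) ⟩
      length (xs ++ us)     ≡⟨ length-++ xs ⟩
      length xs + length us ∎)
    where open ≤-Reasoning

  TReduced⇒≤T : ∀ xs {ys} → TReduced (xs ++ ys) → prodW xs ≤T (prodW xs · prodW ys)
  TReduced⇒≤T xs {ys} tr = length xs , length ys , length xs + length ys ,
    TReduced⇒LenT (TReduced-++ˡ xs tr) ,
    subst (λ z → LenT z (length ys)) (solve (prodW xs ∷ prodW ys ∷ []) [] (V 1) (V 0 ⁻ ⊙ (V 0 ⊙ V 1)) refl) (TReduced⇒LenT (TReduced-++ʳ xs tr)) ,
    subst (λ n → LenT (prodW xs · prodW ys) n) (length-++ xs) (subst (λ z → LenT z (length (xs ++ ys))) (prodW-++ xs ys) (TReduced⇒LenT tr)) ,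
    refl

  refl≢e : ∀ {t} → IsReflection t → t ≢ e
  refl≢e {t} rt refl = contradiction (trans (sym (N-reflection rt)) (N-e e)) λ ()

  ⁻¹·≡e : ∀ {u v} → u ⁻¹ · v ≡ e → v ≡ u
  ⁻¹·≡e {u} {v} p = trans (solve (u ∷ v ∷ []) [] (V 1) (V 0 ⊙ (V 0 ⁻ ⊙ V 1)) refl) (trans (cong (u ·_) p) (identityʳ u))

  TReduced⇒⋖T : ∀ xs {t} → TReduced (xs ++ t ∷ []) → prodW xs ⋖T (prodW xs · t)
  TReduced⇒⋖T xs {t} tr = ≤₀ , (λ p → refl≢e rt (identityʳ-unique (prodW xs) t (sym p))) , between
    where
    rt : IsReflection t
    rt = All.head (All-++⁻ʳ xs (reflections tr))

    ≤₀ : prodW xs ≤T (prodW xs · t)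
    ≤₀ = subst (λ z → prodW xs ≤T (prodW xs · z)) (identityʳ t) (TReduced⇒≤T xs tr)

    between : ∀ w → prodW xs ≤T w → w ≤T (prodW xs · t) → w ≡ prodW xs ⊎ w ≡ prodW xs · t
    between w (a , b , d , La , Lb , Ld , p) (a′ , b′ , d′ , La′ , Lb′ , Ld′ , p′) = cases b b′ Lb Lb′ total
      where
      total : b + b′ ≡ 1
      total = +-cancelˡ-≡ a _ _ (begin
        a + (b + b′) ≡⟨ sym (+-assoc a b b′) ⟩
        (a + b) + b′ ≡⟨ cong (_+ b′) (trans p (LenT-unique Ld La′)) ⟩
        a′ + b′      ≡⟨ p′ ⟩
        d′           ≡⟨ LenT-unique Ld′ (subst (λ z → LenT z (length (xs ++ t ∷ []))) (trans (prodW-++ xs _) (cong (prodW xs ·_) (identityʳ t))) (TReduced⇒LenT tr)) ⟩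
        length (xs ++ t ∷ []) ≡⟨ length-++ xs ⟩
        length xs + 1 ≡⟨ cong (_+ 1) (LenT-unique (TReduced⇒LenT (TReduced-++ˡ xs tr)) La) ⟩
        a + 1 ∎)
        where open ≡-Reasoning

      cases : ∀ b b′ → LenT (prodW xs ⁻¹ · w) b → LenT (w ⁻¹ · (prodW xs · t)) b′ → b + b′ ≡ 1 → w ≡ prodW xs ⊎ w ≡ prodW xs · t
      cases zero    _    Lb _   _ = inj₁ (⁻¹·≡e (LenT-0 Lb))
      cases (suc zero) zero _ Lb′ _ = inj₂ (sym (⁻¹·≡e (LenT-0 Lb′)))

  -- The first letter `t` of a shortest reflection word for `u ⁻¹ · v` gives an element `u · t`
  -- between `u` and `v`, and the covering condition forces `u · t ≡ v`.
  ⋖T⇒reflection : ∀ {u v} → u ⋖T v → IsReflection (u ⁻¹ · v) × (∀ {a} → LenT u a → LenT v (suc a))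
  ⋖T⇒reflection {u} {v} ((a , zero , d , La , Lb , Ld , p) , u≢v , _) = contradiction (sym (⁻¹·≡e (LenT-0 Lb))) u≢v
  ⋖T⇒reflection {u} {v} ((a , suc b , d , ((xs , rxs , refl , pxs) , mxs) , ((t ∷ ys , rt ∷ rys , refl , pys) , mys) , Ld , p) , u≢v , between)
    = case (between (u · t) u≤ ≤v)
    where
    v≡ : v ≡ prodW (xs ++ t ∷ ys)
    v≡ = trans (solve (u ∷ v ∷ []) [] (V 1) (V 0 ⊙ (V 0 ⁻ ⊙ V 1)) refl) (trans (cong₂ _·_ (sym pxs) (sym pys)) (sym (prodW-++ xs (t ∷ ys))))

    tr : TReduced (xs ++ t ∷ ys)
    tr = treduced (All-++⁺ rxs (rt ∷ rys)) λ us rus eq →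
      ≤-trans (≤-reflexive (trans (length-++ xs) p)) (proj₂ Ld us rus (trans eq (sym v≡)))

    tr′ : TReduced ((xs ++ t ∷ []) ++ ys)
    tr′ = subst TReduced (sym (++-assoc xs (t ∷ []) ys)) tr

    ut≡ : prodW (xs ++ t ∷ []) ≡ u · t
    ut≡ = trans (prodW-++ xs _) (cong₂ _·_ pxs (identityʳ t))

    u≤ : u ≤T (u · t)
    u≤ = subst (_≤T (u · t)) pxs (subst (prodW xs ≤T_) (trans (sym (prodW-++ xs _)) ut≡) (TReduced⇒≤T xs (TReduced-++ˡ (xs ++ t ∷ []) tr′)))

    ≤v : (u · t) ≤T v
    ≤v = subst (_≤T v) ut≡ (subst (prodW (xs ++ t ∷ []) ≤T_)
      (trans (sym (prodW-++ (xs ++ t ∷ []) ys)) (trans (cong prodW (++-assoc xs (t ∷ []) ys)) (sym v≡))) (TReduced⇒≤T (xs ++ t ∷ []) tr′))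

    case : u · t ≡ u ⊎ u · t ≡ v → IsReflection (u ⁻¹ · v) × (∀ {a} → LenT u a → LenT v (suc a))
    case (inj₁ q) = contradiction (identityʳ-unique u t q) (refl≢e rt)
    case (inj₂ refl) = subst IsReflection (solve (u ∷ t ∷ []) [] (V 1) (V 0 ⁻ ⊙ (V 0 ⊙ V 1)) refl) rt ,
      λ La → subst (LenT (u · t)) (trans (length-++ xs) (trans (+-comm (length xs) 1)
               (cong suc (LenT-unique {u} ((xs , rxs , refl , pxs) , mxs) La))))
               (subst (λ z → LenT z (length (xs ++ t ∷ []))) ut≡ (TReduced⇒LenT (TReduced-++ˡ (xs ++ t ∷ []) tr′)))

  scan : W → List W → List W
  scan x []       = []
  scan x (t ∷ ts) = x · t ∷ scan (x · t) ts

  rwFrom-scan : ∀ x ts → rwFrom x (scan x ts) ≡ ts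
  rwFrom-scan x []       = refl
  rwFrom-scan x (t ∷ ts) = cong₂ _∷_ (solve (x ∷ t ∷ []) [] (V 0 ⁻ ⊙ (V 0 ⊙ V 1)) (V 1) refl) (rwFrom-scan (x · t) ts)

  lastOr-scan : ∀ x ts → lastOr x (scan x ts) ≡ x · prodW ts
  lastOr-scan x []       = sym (identityʳ x)
  lastOr-scan x (t ∷ ts) = trans (lastOr-scan (x · t) ts) (assoc _ _ _)

  scan-Linked : ∀ {x} xs ts → prodW xs ≡ x → TReduced (xs ++ ts) → Linked _⋖T_ (x ∷ scan x ts)
  scan-Linked xs []       _    _  = [-]
  scan-Linked xs (t ∷ ts) refl tr =
    TReduced⇒⋖T xs (TReduced-++ˡ (xs ++ t ∷ []) tr′) ∷
    scan-Linked (xs ++ t ∷ []) ts (trans (prodW-++ xs _) (cong (prodW xs ·_) (identityʳ t))) tr′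
    where tr′ = subst TReduced (sym (++-assoc xs (t ∷ []) ts)) tr

  TReduced⇒MaxChain : ∀ {c ts} → TReduced ts → prodW ts ≡ c → MaxChain c (scan e ts)
  TReduced⇒MaxChain {ts = ts} tr eq = scan-Linked [] ts refl tr , trans (lastOr-scan e ts) (trans (identityˡ _) eq)

  ⋖T-chain : ∀ {x a} π → Linked _⋖T_ (x ∷ π) → LenT x a →
    All IsReflection (rwFrom x π) × LenT (lastOr x π) (a + length (rwFrom x π)) × x · prodW (rwFrom x π) ≡ lastOr x π
  ⋖T-chain {x} {a} [] _ La = [] , subst (LenT x) (sym (+-identityʳ a)) La , identityʳ x
  ⋖T-chain {x} {a} (y ∷ π) (p ∷ ps) La with ⋖T⇒reflection p
  ... | rt , lift with ⋖T-chain π ps (lift La)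
  ...   | rts , L , eq = rt ∷ rts , subst (LenT _) (sym (+-suc a _)) L ,
          trans (solve (x ∷ y ∷ prodW (rwFrom y π) ∷ []) [] (V 0 ⊙ ((V 0 ⁻ ⊙ V 1) ⊙ V 2)) (V 1 ⊙ V 2) refl) eq

  ≤B⇒ℓ≤ : ∀ {x y} → x ≤B y → ℓ x ≤ ℓ y
  ≤B⇒ℓ≤ ε = ≤-refl
  ≤B⇒ℓ≤ ((t , _ , _ , n , Lx , Ly) ◅ ps) = ≤-trans (≤-trans (≤-reflexive (LenS⇒ℓ Lx)) (≤-trans (n≤1+n n) (≤-reflexive (sym (LenS⇒ℓ Ly))))) (≤B⇒ℓ≤ ps)

  data Up : W → List W → Set where
    []  : ∀ {y} → Up y []
    _∷_ : ∀ {y t ts} → R y t ≡ false → Up (y · t) ts → Up y (t ∷ ts)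

  data Down : W → List W → Set where
    []  : ∀ {y} → Down y []
    _∷_ : ∀ {y t ts} → R y t ≡ true → Down (y · t) ts → Down y (t ∷ ts)

  Concordant⇒Up : ∀ u {x} π → Linked _≤B_ (map (u ·_) (x ∷ π)) → Up (u · x) (rwFrom x π)
  Concordant⇒Up u {x} []      _        = []
  Concordant⇒Up u {x} (y ∷ π) (p ∷ ps) =
    ℓ<⇒R-false (≤-trans (≤B⇒ℓ≤ p) (≤-reflexive (cong ℓ uy))) ∷ subst (λ z → Up z (rwFrom y π)) uy (Concordant⇒Up u π ps)
    where
    uy : u · y ≡ u · x · (x ⁻¹ · y)
    uy = solve (u ∷ x ∷ y ∷ []) [] (V 0 ⊙ V 2) (V 0 ⊙ V 1 ⊙ (V 1 ⁻ ⊙ V 2)) refl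

  Up-ℓ : ∀ {y ts} → All IsReflection ts → Up y ts → ℓ y + length ts ≤ ℓ (y · prodW ts)
  Up-ℓ {y} [] [] = ≤-reflexive (trans (+-identityʳ _) (cong ℓ (sym (identityʳ y))))
  Up-ℓ {y} {t ∷ ts} (rt ∷ rts) (p ∷ ps) = begin
    ℓ y + suc (length ts)     ≡⟨ +-suc (ℓ y) _ ⟩
    suc (ℓ y) + length ts     ≤⟨ +-monoˡ-≤ _ (R-false⇒ℓ< rt p) ⟩
    ℓ (y · t) + length ts     ≤⟨ Up-ℓ rts ps ⟩
    ℓ (y · t · prodW ts)      ≡⟨ cong ℓ (assoc _ _ _) ⟩
    ℓ (y · (t · prodW ts))    ∎
    where open ≤-Reasoning

  -- Every step raises the length by at least one, so the bound on the total rise makes each step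
  -- rise by exactly one, that is, a Bruhat cover.
  Up⇒Concordant : ∀ u x {ts} → All IsReflection ts → Up (u · x) ts → ℓ (u · x · prodW ts) ≤ ℓ (u · x) + length ts →
    Linked _≤B_ (map (u ·_) (x ∷ scan x ts))
  Up⇒Concordant u x [] [] _ = [-]
  Up⇒Concordant u x {t ∷ ts} (rt ∷ rts) (p ∷ ps) total =
    ((t , rt , sym (assoc u x t) , ℓ (u · x) , LenS-ℓ _ , subst (λ z → LenS z (suc (ℓ (u · x)))) (assoc u x t) (ℓ≡⇒LenS one-step)) ◅ ε) ∷
    Up⇒Concordant u (x · t) rts (subst (λ z → Up z ts) (assoc u x t) ps)
      (subst (λ z → ℓ (z · prodW ts) ≤ ℓ z + length ts) (assoc u x t) (≤-trans total′ (≤-reflexive (cong (_+ length ts) (sym one-step)))))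
    where
    total′ : ℓ (u · x · t · prodW ts) ≤ suc (ℓ (u · x)) + length ts
    total′ = ≤-trans (≤-reflexive (cong ℓ (assoc (u · x) t (prodW ts)))) (≤-trans total (≤-reflexive (+-suc _ _)))

    one-step : ℓ (u · x · t) ≡ suc (ℓ (u · x))
    one-step = ≤-antisym (+-cancelʳ-≤ (length ts) _ _ (≤-trans (Up-ℓ rts ps) total′)) (R-false⇒ℓ< rt p)

  -- Counting labelled descending walks

  Weight : Set
  Weight = ℕ → W → ℕ

  infix 4 _≗₂_
  _≗₂_ : Weight → Weight → Set
  f ≗₂ g = ∀ k x → f k x ≡ g k x

  -- Multiplication by `q` of a weight, read as a polynomial in `q` at every group element.
  stay : Weight → Weight
  stay f zero    x = 0
  stay f (suc k) x = f k x

  _·when_ : ℕ → Bool → ℕ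
  n ·when true  = n
  n ·when false = 0

  -- Transposes of right and left multiplication by Tᵢ in the Hecke algebra with
  -- Tᵢ² = 1 + q Tᵢ, where the first argument of a weight is the exponent of q.
  ρ : Fin r → Weight → Weight
  ρ i f k x = f k (x · s i) + stay f k x ·when R x (s i)

  ƛ : Fin r → Weight → Weight
  ƛ j f k x = f k (s j · x) + stay f k x ·when N x (s j)

  stay-cong : ∀ {f g} → f ≗₂ g → stay f ≗₂ stay g
  stay-cong p zero    x = refl
  stay-cong p (suc k) x = p k x

  ρ-cong : ∀ i {f g} → f ≗₂ g → ρ i f ≗₂ ρ i g
  ρ-cong i p k x = cong₂ _+_ (p k _) (cong (_·when R x (s i)) (stay-cong p k x))

  ƛ-cong : ∀ i {f g} → f ≗₂ g → ƛ i f ≗₂ ƛ i g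
  ƛ-cong i p k x = cong₂ _+_ (p k _) (cong (_·when N x (s i)) (stay-cong p k x))

  stay-ρ : ∀ i f k x → stay (ρ i f) k x ≡ stay f k (x · s i) + stay (stay f) k x ·when R x (s i)
  stay-ρ i f (suc k) x = refl
  stay-ρ i f zero x with R x (s i)
  ... | true  = refl
  ... | false = refl

  stay-ƛ : ∀ j f k x → stay (ƛ j f) k x ≡ stay f k (s j · x) + stay (stay f) k x ·when N x (s j)
  stay-ƛ j f (suc k) x = refl
  stay-ƛ j f zero x with N x (s j)
  ... | true  = refl
  ... | false = refl

  -- The flag `δ` marks `s j · x ≡ x · s i`, the only case in which one multiplication changes the
  -- descent tested by the other. There the two terms in `q` have equal values and equal conditions;
  -- otherwise the expansions differ by the order of summation.
  ρ-ƛ-comm : ∀ i j f → ρ i (ƛ j f) ≗₂ ƛ j (ρ i f)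
  ρ-ƛ-comm i j f k x = begin
    (f k (s j · (x · s i)) + F k (x · s i) ·when N (x · s i) (s j)) + stay (ƛ j f) k x ·when R x (s i)
      ≡⟨ cong₂ (λ b n → (f k (s j · (x · s i)) + F k (x · s i) ·when b) + n ·when R x (s i)) Nxs (stay-ƛ j f k x) ⟩
    (f k (s j · (x · s i)) + F k (x · s i) ·when (N x (s j) xor δ)) + (F k (s j · x) + FF ·when N x (s j)) ·when R x (s i)
      ≡⟨ cong (λ z → (f k z + F k (x · s i) ·when (N x (s j) xor δ)) + (F k (s j · x) + FF ·when N x (s j)) ·when R x (s i)) (sym (assoc _ _ _)) ⟩
    (f k (s j · x · s i) + F k (x · s i) ·when (N x (s j) xor δ)) + (F k (s j · x) + FF ·when N x (s j)) ·when R x (s i)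
      ≡⟨ shuffle (N x (s j)) (R x (s i)) δ (f k (s j · x · s i)) (F k (x · s i)) (F k (s j · x)) FF
           (λ p → cong (F k) (sxs (==-true p))) (λ p → NR (==-true p)) ⟩
    (f k (s j · x · s i) + F k (s j · x) ·when (R x (s i) xor δ)) + (F k (x · s i) + FF ·when R x (s i)) ·when N x (s j)
      ≡⟨ sym (cong₂ (λ b n → (f k (s j · x · s i) + F k (s j · x) ·when b) + n ·when N x (s j)) Rsx (stay-ρ i f k x)) ⟩
    (f k (s j · x · s i) + F k (s j · x) ·when R (s j · x) (s i)) + stay (ρ i f) k x ·when N x (s j) ∎
    where
    open ≡-Reasoning
    F = stay f
    FF = stay (stay f) k x
    δ = x ⁻¹ · s j · x == s i

    Nxs : N (x · s i) (s j) ≡ N x (s j) xor δ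
    Nxs = trans (N-· x (s i) (s j)) (cong (N x (s j) xor_) (N-s i _))

    sxs : x ⁻¹ · s j · x ≡ s i → x · s i ≡ s j · x
    sxs p = trans (cong (x ·_) (sym p)) (solve (x ∷ []) (σ j ∷ []) (V 0 ⊙ (V 0 ⁻ ⊙ I 0 ⊙ V 0)) (I 0 ⊙ V 0) refl)

    NR : x ⁻¹ · s j · x ≡ s i → N x (s j) ≡ R x (s i)
    NR p = sym (trans (N-⁻¹ x (s i)) (cong (N x) (trans (cong (_· x ⁻¹) (sxs p))
      (solve (x ∷ []) (σ j ∷ []) (I 0 ⊙ V 0 ⊙ V 0 ⁻) (I 0) refl))))

    Rsx : R (s j · x) (s i) ≡ R x (s i) xor δ
    Rsx = trans (R-· (s j) x (s i)) (cong (R x (s i) xor_)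
      (trans (cong (λ z → N z (x · s i · x ⁻¹)) (solve [] (σ j ∷ []) (I 0 ⁻) (I 0) refl))
        (trans (N-s j _) (==-cong
          (λ p → trans (cong (λ z → x ⁻¹ · z · x) (sym p)) (solve (x ∷ []) (σ i ∷ []) (V 0 ⁻ ⊙ (V 0 ⊙ I 0 ⊙ V 0 ⁻) ⊙ V 0) (I 0) refl))
          (λ p → trans (cong (λ z → x · z · x ⁻¹) (sym p)) (solve (x ∷ []) (σ j ∷ []) (V 0 ⊙ (V 0 ⁻ ⊙ I 0 ⊙ V 0) ⊙ V 0 ⁻) (I 0) refl))))))

    shuffle : ∀ a b d m p q n → (d ≡ true → p ≡ q) → (d ≡ true → a ≡ b) →
      (m + p ·when (a xor d)) + (q + n ·when a) ·when b ≡ (m + q ·when (b xor d)) + (p + n ·when b) ·when a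
    shuffle a b true m p q n h₁ h₂ with h₁ refl | h₂ refl
    ... | refl | refl = refl
    shuffle true  true  false m p q n _ _ = begin
      (m + p) + (q + n) ≡⟨ sym (+-assoc (m + p) q n) ⟩
      (m + p + q) + n   ≡⟨ cong (_+ n) (trans (+-assoc m p q) (trans (cong (m +_) (+-comm p q)) (sym (+-assoc m q p)))) ⟩
      (m + q + p) + n   ≡⟨ +-assoc (m + q) p n ⟩
      (m + q) + (p + n) ∎
    shuffle true  false false m p q n _ _ = trans (+-identityʳ (m + p)) (cong₂ _+_ (sym (+-identityʳ m)) (sym (+-identityʳ p)))
    shuffle false true  false m p q n _ _ = trans (cong₂ _+_ (+-identityʳ m) (+-identityʳ q)) (sym (+-identityʳ (m + q)))
    shuffle false false false m p q n _ _ = refl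

  ρ* : List (Fin r) → Weight → Weight
  ρ* []      f = f
  ρ* (i ∷ a) f = ρ i (ρ* a f)

  -- The first letter acts innermost, so that evaluation at `e` builds the word by left
  -- multiplication from its last letter.
  ƛ* : List (Fin r) → Weight → Weight
  ƛ* []      f = f
  ƛ* (i ∷ b) f = ƛ* b (ƛ i f)

  ƛ*-cong : ∀ b {f g} → f ≗₂ g → ƛ* b f ≗₂ ƛ* b g
  ƛ*-cong []      p = p
  ƛ*-cong (i ∷ b) p = ƛ*-cong b (ƛ-cong i p)

  ρ*-ƛ-comm : ∀ a j f → ρ* a (ƛ j f) ≗₂ ƛ j (ρ* a f)
  ρ*-ƛ-comm []      j f k x = refl
  ρ*-ƛ-comm (i ∷ a) j f k x = trans (ρ-cong i (ρ*-ƛ-comm a j f) k x) (ρ-ƛ-comm i j (ρ* a f) k x)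

  ρ*-ƛ*-comm : ∀ a b f → ρ* a (ƛ* b f) ≗₂ ƛ* b (ρ* a f)
  ρ*-ƛ*-comm a []      f k x = refl
  ρ*-ƛ*-comm a (j ∷ b) f k x = trans (ρ*-ƛ*-comm a b (ƛ j f) k x) (ƛ*-cong b (ρ*-ƛ-comm a j f) k x)

  -- A reduced word meets no descent while it is built up, so no term in `q` arises.
  ƛ*-at-e : ∀ {b} → Reduced b → ∀ f k → ƛ* b f k e ≡ f k (prod b)
  ƛ*-at-e []                _ _ = refl
  ƛ*-at-e {i ∷ b} (p ∷ rb) f k = trans (ƛ*-at-e rb (ƛ i f) k)
    (trans (cong (λ z → f k (s i · prod b) + stay f k (prod b) ·when z) p) (+-identityʳ _))

  data Ascending : W → List (Fin r) → Set where
    []  : ∀ {p} → Ascending p []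
    _∷_ : ∀ {p i a} → R p (s i) ≡ false → Ascending (p · s i) a → Ascending p (i ∷ a)

  ρ*-at : ∀ {p a} → Ascending p a → ∀ f k → ρ* a f k p ≡ f k (p · prod a)
  ρ*-at {p} []                f k = cong (f k) (sym (identityʳ p))
  ρ*-at {p} {i ∷ a} (up ∷ asc) f k = trans (cong (λ z → ρ* a f k (p · s i) + stay (ρ* a f) k p ·when z) up)
    (trans (+-identityʳ _) (trans (ρ*-at asc f k) (cong (f k) (assoc _ _ _))))

  ℓ-additive⇒Ascending : ∀ p a → ℓ p + length a ≤ ℓ (p · prod a) → Ascending p a
  ℓ-additive⇒Ascending p [] _ = []
  ℓ-additive⇒Ascending p (i ∷ a) le = ℓ<⇒R-false (≤-trans (n≤1+n _) ups) ∷
    ℓ-additive⇒Ascending (p · s i) a (≤-trans (+-monoˡ-≤ (length a) ≤1) le′)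
    where
    ≤1 : ℓ (p · s i) ≤ suc (ℓ p)
    ≤1 = ≤-trans (≤-reflexive (cong (λ z → ℓ (p · z)) (sym (identityʳ (s i))))) (≤-trans (ℓ-·prod p (i ∷ [])) (≤-reflexive (+-comm (ℓ p) 1)))

    le′ : suc (ℓ p) + length a ≤ ℓ (p · s i · prod a)
    le′ = ≤-trans (≤-reflexive (sym (+-suc (ℓ p) (length a)))) (≤-trans le (≤-reflexive (cong ℓ (sym (assoc _ _ _)))))

    ups : suc (ℓ p) ≤ ℓ (p · s i)
    ups = +-cancelʳ-≤ (length a) _ _ (≤-trans le′ (ℓ-·prod (p · s i) a))

  Reduced⇒Ascending : ∀ {a} → Reduced a → Ascending e a
  Reduced⇒Ascending {a} ra = ℓ-additive⇒Ascending e a (≤-reflexive (trans (cong (_+ length a) (Reduced⇒ℓ [])) (trans (sym (Reduced⇒ℓ ra)) (cong ℓ (sym (identityˡ _))))))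

  indicator : W → Weight
  indicator z zero    x = 1 ·when (x == z)
  indicator z (suc k) x = 0

  ƛ-indicator : ∀ i z → N z (s i) ≡ false → ƛ i (indicator z) ≗₂ indicator (s i · z)
  ƛ-indicator i z p zero x = trans (cong₂ _+_ (cong (1 ·when_) (==-cong
      (λ { refl → solve (x ∷ []) (σ i ∷ []) (V 0) (I 0 ⊙ (I 0 ⊙ V 0)) refl })
      (λ { refl → solve (z ∷ []) (σ i ∷ []) (I 0 ⊙ (I 0 ⊙ V 0)) (V 0) refl }))) (vanish (N x (s i)))) (+-identityʳ _)
    where
    vanish : ∀ b → 0 ·when b ≡ 0
    vanish true  = refl
    vanish false = refl
  ƛ-indicator i z p (suc zero) x with x ≟ z
  ... | yes refl rewrite p = refl
  ... | no _ with N x (s i)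
  ...   | true  = refl
  ...   | false = refl
  ƛ-indicator i z p (suc (suc k)) x with N x (s i)
  ... | true  = refl
  ... | false = refl

  ƛ*-++ : ∀ β γ f → ƛ* (β ++ γ) f ≡ ƛ* γ (ƛ* β f)
  ƛ*-++ []      γ f = refl
  ƛ*-++ (i ∷ β) γ f = ƛ*-++ β γ (ƛ i f)

  Reduced-++ˡ : ∀ β {γ} → Reduced (β ++ γ) → Reduced β
  Reduced-++ˡ β {γ} rβγ = minimal⇒Reduced β λ b eq → +-cancelʳ-≤ (length γ) _ _
    (≤-trans (≤-reflexive (sym (length-++ β))) (≤-trans
      (Reduced-minimal rβγ (b ++ γ) (trans (prod-++ b γ) (trans (cong (_· prod γ) eq) (sym (prod-++ β γ)))))
      (≤-reflexive (length-++ b))))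

  module Longest (w₀ : W) (N-w₀ : ∀ {t} → IsReflection t → N w₀ t ≡ true) where

    -- Right multiplication by `w₀` complements left inversions. Hence `s i` is no descent of
    -- `prod (i ∷ b) · w₀`, and each letter is cancelled by `ƛ-indicator`.
    ƛ*-indicator : ∀ {b} → Reduced b → ƛ* b (indicator (prod b · w₀)) ≗₂ indicator w₀
    ƛ*-indicator [] k x = cong (λ z → indicator z k x) (identityˡ w₀)
    ƛ*-indicator {i ∷ b} (p ∷ rb) k x = trans
      (ƛ*-cong b (λ k x → trans (ƛ-indicator i _ down k x)
        (cong (λ z → indicator z k x) (solve (prod b ∷ w₀ ∷ []) (σ i ∷ []) (I 0 ⊙ (I 0 ⊙ V 0 ⊙ V 1)) (V 0 ⊙ V 1) refl))) k x)
      (ƛ*-indicator rb k x)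
      where
      down : N (s i · prod b · w₀) (s i) ≡ false
      down = trans (N-· (s i · prod b) w₀ (s i)) (cong₂ _xor_ (trans (N-s· i (prod b)) (cong not p)) (N-w₀ (refl-conj⁻¹ (s i · prod b) (refl-s i))))

    -- Here `m` bounds the degree of `f` in `q`. Every `s i` is a descent of `w₀`, so each letter
    -- raises the bound by one and carries the coefficient 1 at `w₀` over to the new top degree.
    ƛ*-at-w₀ : ∀ γ m f → (∀ k x → m < k → f k x ≡ 0) → f m w₀ ≡ 1 → ƛ* γ f (m + length γ) w₀ ≡ 1
    ƛ*-at-w₀ []      m f vanish one = trans (cong (λ k → f k w₀) (+-identityʳ m)) one
    ƛ*-at-w₀ (i ∷ γ) m f vanish one = trans (cong (λ k → ƛ* γ (ƛ i f) k w₀) (+-suc m (length γ)))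
      (ƛ*-at-w₀ γ (suc m) (ƛ i f) vanish′ (cong₂ _+_ (vanish (suc m) _ ≤-refl) (trans (cong (f m w₀ ·when_) (N-w₀ (refl-s i))) one)))
      where
      vanish′ : ∀ k x → suc m < k → ƛ i f k x ≡ 0
      vanish′ (suc k) x (s≤s m<k) rewrite vanish (suc k) (s i · x) (≤-trans m<k (n≤1+n k)) | vanish k x m<k with N x (s i)
      ... | true  = refl
      ... | false = refl

    -- Both sides expand the product of T_v and T_{w₀}, once along a reduced word of w₀
    -- and once along one of v; the latter expansion is easy since w₀ is a maximum.
    count-one : ∀ {a} → Reduced a → prod a ≡ w₀ → ∀ β γ → Reduced (β ++ γ) →
      ρ* a (indicator (prod β · w₀)) (length γ) (prod (β ++ γ)) ≡ 1
    count-one {a} ra refl β γ rβγ = begin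
      ρ* a f k (prod (β ++ γ))           ≡⟨ sym (ƛ*-at-e rβγ (ρ* a f) k) ⟩
      ƛ* (β ++ γ) (ρ* a f) k e           ≡⟨ sym (ρ*-ƛ*-comm a (β ++ γ) f k e) ⟩
      ρ* a (ƛ* (β ++ γ) f) k e           ≡⟨ ρ*-at (Reduced⇒Ascending ra) _ k ⟩
      ƛ* (β ++ γ) f k (e · prod a)       ≡⟨ cong (ƛ* (β ++ γ) f k) (identityˡ _) ⟩
      ƛ* (β ++ γ) f k (prod a)           ≡⟨ cong (λ g → g k (prod a)) (ƛ*-++ β γ f) ⟩
      ƛ* γ (ƛ* β f) k (prod a)           ≡⟨ ƛ*-cong γ (ƛ*-indicator (Reduced-++ˡ β rβγ)) k (prod a) ⟩
      ƛ* γ (indicator (prod a)) k (prod a) ≡⟨ ƛ*-at-w₀ γ 0 (indicator (prod a)) (λ { (suc k) x _ → refl }) (cong (1 ·when_) (==-refl _)) ⟩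
      1 ∎
      where
      open ≡-Reasoning
      f = indicator (prod β · prod a)
      k = length γ

  -- Walks as the terms of the expansion along a word.

  labels : W → List (Fin r) → List W
  labels p []      = []
  labels p (i ∷ a) = p · s i · p ⁻¹ ∷ labels (p · s i) a

  map-inversions : ∀ p a → map (λ t → p · t · p ⁻¹) (inversions a) ≡ labels p a
  map-inversions p []      = refl
  map-inversions p (i ∷ a) = cong (p · s i · p ⁻¹ ∷_) (trans (sym (map-∘ (inversions a)))
    (trans (map-cong (λ t → solve (p ∷ t ∷ []) (σ i ∷ []) (V 0 ⊙ (I 0 ⊙ V 1 ⊙ I 0) ⊙ V 0 ⁻) ((V 0 ⊙ I 0) ⊙ V 1 ⊙ (V 0 ⊙ I 0) ⁻) refl) (inversions a))
      (map-inversions (p · s i) a)))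

  inversions≡labels : ∀ a → inversions a ≡ labels e a
  inversions≡labels a = trans (trans (sym (map-id (inversions a)))
    (map-cong (λ t → solve (t ∷ []) [] (V 0) (⟨e⟩ ⊙ V 0 ⊙ ⟨e⟩ ⁻) refl) (inversions a))) (map-inversions e a)

  module Walks (z : W) where

    private
      count : List (Fin r) → Weight
      count a = ρ* a (indicator z)

    -- As the step from `p` to `p · s i` ascends, the cocycle rule turns a descent of `y · p` at the
    -- letter into a descent of `y` at its label.
    R-label : ∀ {p i} → R p (s i) ≡ false → ∀ y → R (y · p) (s i) ≡ R y (p · s i · p ⁻¹)
    R-label {p} {i} up y = trans (R-· y p (s i)) (cong (_xor R y (p · s i · p ⁻¹)) up)

    after-label : ∀ y p i → y · (p · s i · p ⁻¹) · (p · s i) ≡ y · p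
    after-label y p i = solve (y ∷ p ∷ []) (σ i ∷ []) (V 0 ⊙ (V 1 ⊙ I 0 ⊙ V 1 ⁻) ⊙ (V 1 ⊙ I 0)) (V 0 ⊙ V 1) refl

    -- A choice of terms in `count a k (y · p)`. `skip` moves the letter into the prefix with `y`
    -- fixed. `take` uses the term in `q`, where the element `y · p` stays the same although the
    -- prefix grows, so `y` is multiplied by the label.
    record Walk (p : W) (a : List (Fin r)) (k : ℕ) (y : W) (ts : List W) : Set where
      constructor walk
      field
        sub  : ts ⊆ labels p a
        size : length ts ≡ k
        down : Down y ts
        end  : y · prodW ts · (p · prod a) ≡ z

    skip : ∀ {p i a k y ts} → Walk (p · s i) a k y ts → Walk p (i ∷ a) k y ts
    skip {y = y} {ts} (walk sb sz d en) = walk (_ ∷ʳ sb) sz d (trans (cong (y · prodW ts ·_) (sym (assoc _ _ _))) en)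

    take : ∀ {p i a k y ts} → R y (p · s i · p ⁻¹) ≡ true → Walk (p · s i) a k (y · (p · s i · p ⁻¹)) ts →
      Walk p (i ∷ a) (suc k) y (p · s i · p ⁻¹ ∷ ts)
    take eq (walk sb sz d en) = walk (refl ∷ sb) (cong suc sz) (eq ∷ d) (trans (cong₂ _·_ (sym (assoc _ _ _)) (sym (assoc _ _ _))) en)

    skip⁻¹ : ∀ {p i a k y ts} → ts ⊆ labels (p · s i) a → length ts ≡ k → Down y ts →
      y · prodW ts · (p · prod (i ∷ a)) ≡ z → Walk (p · s i) a k y ts
    skip⁻¹ {y = y} {ts} sb sz d en = walk sb sz d (trans (cong (y · prodW ts ·_) (assoc _ _ _)) en)

    take⁻¹ : ∀ {p i a k y ts} → let t = p · s i · p ⁻¹ in ts ⊆ labels (p · s i) a → suc (length ts) ≡ suc k → Down (y · t) ts →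
      y · prodW (t ∷ ts) · (p · prod (i ∷ a)) ≡ z → Walk (p · s i) a k (y · t) ts
    take⁻¹ sb sz d en = walk sb (suc-injective sz) d (trans (cong₂ _·_ (assoc _ _ _) (assoc _ _ _)) en)

    find : ∀ {p} a k y → Ascending p a → 1 ≤ count a k (y · p) → ∃[ ts ] Walk p a k y ts
    find {p} [] zero y _ pos with (y · p) ≟ z
    ... | yes eq = [] , walk [] refl [] (trans (cong₂ _·_ (identityʳ y) (identityʳ p)) eq)
    find {p} (i ∷ a) k y (up ∷ asc) pos with count a k (y · p · s i) in c₁
    ... | suc _ with find a k y asc (≤-trans (s≤s z≤n) (≤-reflexive (sym (trans (cong (count a k) (sym (assoc _ _ _))) c₁))))
    ...   | ts , w = ts , skip w
    find {p} (i ∷ a) k y (up ∷ asc) pos | zero with R (y · p) (s i) in eq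
    find {p} (i ∷ a) (suc k) y (up ∷ asc) pos | zero | true
      with find a k (y · (p · s i · p ⁻¹)) asc (≤-trans pos (≤-reflexive (cong (count a k) (sym (after-label y p i)))))
    ... | ts , w = p · s i · p ⁻¹ ∷ ts , take (trans (sym (R-label up y)) eq) w

    count-skip : ∀ p i a k y → count a k (y · (p · s i)) ≤ count (i ∷ a) k (y · p)
    count-skip p i a k y = ≤-trans (≤-reflexive (cong (count a k) (sym (assoc _ _ _)))) (m≤m+n _ _)

    count-split : ∀ {p i} a k y → R p (s i) ≡ false → R y (p · s i · p ⁻¹) ≡ true →
      count (i ∷ a) (suc k) (y · p) ≡ count a (suc k) (y · (p · s i)) + count a k (y · (p · s i · p ⁻¹) · (p · s i))
    count-split {p} {i} a k y up eq rewrite trans (R-label up y) eq =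
      cong₂ _+_ (cong (count a (suc k)) (assoc _ _ _)) (cong (count a k) (sym (after-label y p i)))

    counted : ∀ {p a k y ts} → Ascending p a → Walk p a k y ts → 1 ≤ count a k (y · p)
    counted {p} {[]} {_} {y} [] (walk [] refl [] en)
      rewrite trans (sym (cong₂ _·_ (identityʳ y) (identityʳ p))) en | ==-refl z = ≤-refl
    counted {p} {i ∷ a} {k} {y} (up ∷ asc) (walk (_ ∷ʳ sb) sz d en) =
      ≤-trans (counted asc (skip⁻¹ sb sz d en)) (count-skip p i a k y)
    counted {p} {i ∷ a} {suc k} {y} (up ∷ asc) (walk (refl ∷ sb) sz (eq ∷ d) en) =
      ≤-trans (counted asc (take⁻¹ sb sz d en)) (≤-trans (m≤n+m _ _) (≤-reflexive (sym (count-split a k y up eq))))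

    two : ∀ {p i a k y ts ts′} → Ascending p (i ∷ a) → R y (p · s i · p ⁻¹) ≡ true → Walk (p · s i) a (suc k) y ts →
      Walk (p · s i) a k (y · (p · s i · p ⁻¹)) ts′ → 2 ≤ count (i ∷ a) (suc k) (y · p)
    two {a = a} {k} {y} (up ∷ asc) eq w w′ = ≤-trans (+-mono-≤ (counted asc w) (counted asc w′)) (≤-reflexive (sym (count-split a k y up eq)))

    -- Where two walks first part, one skips a letter and the other takes it; they count towards
    -- different summands, and the value would be at least 2.
    unique : ∀ {p a k y ts ts′} → Ascending p a → count a k (y · p) ≤ 1 → Walk p a k y ts → Walk p a k y ts′ → ts ≡ ts′
    unique [] _ (walk [] _ _ _) (walk [] _ _ _) = refl
    unique {p} {i ∷ a} {k} {y} (up ∷ asc) le (walk (_ ∷ʳ sb) sz d en) (walk (_ ∷ʳ sb′) sz′ d′ en′) =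
      unique asc (≤-trans (count-skip p i a k y) le) (skip⁻¹ sb sz d en) (skip⁻¹ sb′ sz′ d′ en′)
    unique {p} {i ∷ a} {suc k} {y} (up ∷ asc) le (walk (refl ∷ sb) sz (eq ∷ d) en) (walk (refl ∷ sb′) sz′ (_ ∷ d′) en′) =
      cong (_ ∷_) (unique asc (≤-trans (m≤n+m _ _) (≤-trans (≤-reflexive (sym (count-split a k y up eq))) le))
        (take⁻¹ sb sz d en) (take⁻¹ sb′ sz′ d′ en′))
    unique {p} {i ∷ a} {suc k} asc le (walk (_ ∷ʳ sb) sz d en) (walk (refl ∷ sb′) sz′ (eq ∷ d′) en′) =
      contradiction le (<⇒≱ (two asc eq (skip⁻¹ sb sz d en) (take⁻¹ sb′ sz′ d′ en′)))
    unique {p} {i ∷ a} {suc k} asc le (walk (refl ∷ sb) sz (eq ∷ d) en) (walk (_ ∷ʳ sb′) sz′ d′ en′) =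
      contradiction le (<⇒≱ (two asc eq (skip⁻¹ sb′ sz′ d′ en′) (take⁻¹ sb sz d en)))

  -- Reflection orders and sorting words

  ∈-inversions⇒N : ∀ {a t} → Reduced a → t ∈ inversions a → N (prod a) t ≡ true
  ∈-inversions⇒N {i ∷ a} (p ∷ ra) (here refl) = trans (N-s· i (prod a)) (cong not p)
  ∈-inversions⇒N {i ∷ a} {t} (p ∷ ra) (there t∈) with ∈-map⁻ (λ t → s i · t · s i) t∈
  ... | t′ , t′∈ , refl = trans (N-· (s i) (prod a) t) (cong₂ _xor_
        (trans (N-s i t) (==-false λ q → contradiction (trans (sym p) (trans (cong (N (prod a)) (s≡t′ q)) Nt′)) λ ()))
        (trans (cong (N (prod a)) (solve (t′ ∷ []) (σ i ∷ []) (I 0 ⁻ ⊙ (I 0 ⊙ V 0 ⊙ I 0) ⊙ I 0) (V 0) refl)) Nt′))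
    where
    Nt′ : N (prod a) t′ ≡ true
    Nt′ = ∈-inversions⇒N ra t′∈

    s≡t′ : s i · t′ · s i ≡ s i → s i ≡ t′
    s≡t′ q = sym (trans (solve (t′ ∷ []) (σ i ∷ []) (V 0) (I 0 ⊙ (I 0 ⊙ V 0 ⊙ I 0) ⊙ I 0) refl)
      (trans (cong (λ z → s i · z · s i) q) (solve [] (σ i ∷ []) (I 0 ⊙ I 0 ⊙ I 0) (I 0) refl)))

  N⇒∈-inversions : ∀ a {t} → N (prod a) t ≡ true → t ∈ inversions a
  N⇒∈-inversions [] {t} p = contradiction (trans (sym p) (N-e t)) λ ()
  N⇒∈-inversions (i ∷ a) {t} p with t ≟ s i
  ... | yes t≡s = here t≡s
  ... | no t≢s = there (subst (_∈ map (λ t → s i · t · s i) (inversions a))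
        (solve (t ∷ []) (σ i ∷ []) (I 0 ⊙ (I 0 ⁻ ⊙ V 0 ⊙ I 0) ⊙ I 0) (V 0) refl)
        (∈-map⁺ (λ t → s i · t · s i) (N⇒∈-inversions a {s i ⁻¹ · t · s i}
          (trans (sym (trans (N-· (s i) (prod a) t) (cong (_xor N (prod a) (s i ⁻¹ · t · s i)) (trans (N-s i t) (==-false t≢s))))) p))))

  inversions-reflections : ∀ a → All IsReflection (inversions a)
  inversions-reflections []      = []
  inversions-reflections (i ∷ a) = refl-s i ∷ All.tabulate λ t∈ → conjugate (∈-map⁻ (λ t → s i · t · s i) t∈)
    where
    conjugate : ∀ {t} → ∃[ t′ ] (t′ ∈ inversions a × t ≡ s i · t′ · s i) → IsReflection t
    conjugate (t′ , t′∈ , refl) = subst IsReflection (solve (t′ ∷ []) (σ i ∷ []) (I 0 ⊙ V 0 ⊙ I 0 ⁻) (I 0 ⊙ V 0 ⊙ I 0) refl)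
      (refl-conj (s i) (All.lookup (inversions-reflections a) t′∈))

  inversions-unique : ∀ {a} → Reduced a → Unique (inversions a)
  inversions-unique [] = []
  inversions-unique {i ∷ a} (p ∷ ra) =
    All.tabulate (λ { t∈ refl → fresh (∈-map⁻ (λ t → s i · t · s i) t∈) })
    ∷ Unique-map⁺ (λ {t} {t′} q → ∙-cancelˡ (s i) t t′ (∙-cancelʳ (s i) (s i · t) (s i · t′) q)) (inversions-unique ra)
    where
    fresh : ∃[ t ] (t ∈ inversions a × s i ≡ s i · t · s i) → ⊥
    fresh (t , t∈ , q) = contradiction (trans (sym p) (trans (cong (N (prod a)) s≡t) (∈-inversions⇒N ra t∈))) λ ()
      where
      s≡t : s i ≡ t
      s≡t = trans (solve [] (σ i ∷ []) (I 0) (I 0 ⊙ I 0 ⊙ I 0) refl) (trans (cong (λ z → s i · z · s i) q)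
        (solve (t ∷ []) (σ i ∷ []) (I 0 ⊙ (I 0 ⊙ V 0 ⊙ I 0) ⊙ I 0) (V 0) refl))

  Commute : W → W → Set
  Commute x y = x · y ≡ y · x

  SwapBy-map : ∀ (f : W → W) → (∀ {x y} → Commute x y → Commute (f x) (f y)) →
    ∀ {xs ys} → SwapBy Commute xs ys → SwapBy Commute (map f xs) (map f ys)
  SwapBy-map f h (here c)  = here (h c)
  SwapBy-map f h (there p) = there (SwapBy-map f h p)

  -- For commuting `s i` and `s j` the second inversion `s i · s j · s i` is `s j`, and the later
  -- inversions are conjugated by the same product in either order.
  SwapBy-inversions : ∀ {a b} → SwapBy (λ i j → s i · s j ≡ s j · s i) a b → SwapBy Commute (inversions a) (inversions b)
  SwapBy-inversions (there {i} {a} {b} p) = there (SwapBy-map _ conj (SwapBy-inversions p))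
    where
    conj : ∀ {x y} → Commute x y → Commute (s i · x · s i) (s i · y · s i)
    conj {x} {y} c = trans (solve (x ∷ y ∷ []) (σ i ∷ []) ((I 0 ⊙ V 0 ⊙ I 0) ⊙ (I 0 ⊙ V 1 ⊙ I 0)) (I 0 ⊙ (V 0 ⊙ V 1) ⊙ I 0) refl)
      (trans (cong (λ z → s i · z · s i) c) (solve (x ∷ y ∷ []) (σ i ∷ []) (I 0 ⊙ (V 1 ⊙ V 0) ⊙ I 0) ((I 0 ⊙ V 1 ⊙ I 0) ⊙ (I 0 ⊙ V 0 ⊙ I 0)) refl))
  SwapBy-inversions (here {i} {j} {a} c) = subst (λ xs → SwapBy Commute (inversions (i ∷ j ∷ a)) xs) same (here commute)
    where
    sjs : s i · s j · s i ≡ s j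
    sjs = trans (cong (_· s i) c) (solve [] (σ i ∷ σ j ∷ []) (I 1 ⊙ I 0 ⊙ I 0) (I 1) refl)

    sis : s j · s i · s j ≡ s i
    sis = trans (cong (_· s j) (sym c)) (solve [] (σ i ∷ σ j ∷ []) (I 0 ⊙ I 1 ⊙ I 1) (I 0) refl)

    commute : Commute (s i) (s i · s j · s i)
    commute = trans (cong (s i ·_) sjs) (trans c (cong (_· s i) (sym sjs)))

    same : (s i · s j · s i) ∷ s i ∷ map (λ t → s i · t · s i) (map (λ t → s j · t · s j) (inversions a)) ≡ inversions (j ∷ i ∷ a)
    same = cong₂ _∷_ sjs (cong₂ _∷_ (sym sis) (trans (sym (map-∘ (inversions a))) (trans (map-cong swap (inversions a)) (map-∘ (inversions a)))))
      where
      swap : ∀ t → s i · (s j · t · s j) · s i ≡ s j · (s i · t · s i) · s j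
      swap t = trans (solve (t ∷ []) (σ i ∷ σ j ∷ []) (I 0 ⊙ (I 1 ⊙ V 0 ⊙ I 1) ⊙ I 0) ((I 0 ⊙ I 1) ⊙ V 0 ⊙ (I 1 ⊙ I 0)) refl)
        (trans (cong₂ (λ y z → y · t · z) c (sym c)) (solve (t ∷ []) (σ i ∷ σ j ∷ []) ((I 1 ⊙ I 0) ⊙ V 0 ⊙ (I 0 ⊙ I 1)) (I 1 ⊙ (I 0 ⊙ V 0 ⊙ I 0) ⊙ I 1) refl))

  CommEqBy-precedes : ∀ {a b t t′} → ¬ Commute t t′ → CommEqBy (λ i j → s i · s j ≡ s j · s i) a b →
    (t ∷ t′ ∷ []) ⊆ inversions a → (t ∷ t′ ∷ []) ⊆ inversions b
  CommEqBy-precedes ¬c ε        p = p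
  CommEqBy-precedes ¬c (x ◅ xs) p = CommEqBy-precedes ¬c xs (SwapBy-precedes ¬c (SwapBy-inversions x) p)

  precedes⇒LeftOf : ∀ {t t′ ts} → (t ∷ t′ ∷ []) ⊆ ts → LeftOf t t′ ts
  precedes⇒LeftOf (_ ∷ʳ p) with precedes⇒LeftOf p
  ... | i , j , i≤j , eq , eq′ = fsuc i , fsuc j , s≤s i≤j , eq , eq′
  precedes⇒LeftOf (refl ∷ p) = fzero , fsuc (Any.index (to∈ p)) , z≤n , refl , sym (lookup-index (to∈ p))

  -- `LeftOf` allows equal positions; distinctness makes the order strict.
  LeftOf⇒precedes : ∀ {t t′} ts → t ≢ t′ → LeftOf t t′ ts → (t ∷ t′ ∷ []) ⊆ ts
  LeftOf⇒precedes (_ ∷ ts) t≢t′ (fzero  , fzero  , _ , refl , refl)     = contradiction refl t≢t′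
  LeftOf⇒precedes (_ ∷ ts) t≢t′ (fzero  , fsuc j , _ , refl , refl)     = refl ∷ from∈ (∈-lookup j)
  LeftOf⇒precedes (_ ∷ ts) t≢t′ (fsuc i , fsuc j , s≤s i≤j , eq , eq′)  = _ ∷ʳ LeftOf⇒precedes ts t≢t′ (i , j , i≤j , eq , eq′)

  CommEqBy-∈ : ∀ {a b t} → CommEqBy (λ i j → s i · s j ≡ s j · s i) a b → t ∈ inversions a → t ∈ inversions b
  CommEqBy-∈ ε        p = p
  CommEqBy-∈ (x ◅ xs) p = CommEqBy-∈ xs (∈-SwapBy (SwapBy-inversions x) p)

  ∈⇒LeftOf : ∀ {t ts} → t ∈ ts → LeftOf t t ts
  ∈⇒LeftOf t∈ = Any.index t∈ , Any.index t∈ , ≤-refl , sym (lookup-index t∈) , sym (lookup-index t∈)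

  Maximal : W → Set
  Maximal w = ∀ {t} → IsReflection t → N w t ≡ true

  IsLongest⇒Maximal : ∀ {w} → IsLongest w → Maximal w
  IsLongest⇒Maximal {w} longest {t} rt with N w t in eq
  ... | true  = refl
  ... | false = contradiction (longest (t · w) _ _ (LenS-ℓ _) (LenS-ℓ w)) (<⇒≱ (N-false⇒ℓ< rt eq))

  -- The inversions of `v ⁻¹` and `w` cancel in `v ⁻¹ · w`, whose reduced word is therefore empty.
  Maximal-unique : ∀ {v w} → Maximal v → Maximal w → v ≡ w
  Maximal-unique {v} {w} mv mw = trivial (reducedWord (v ⁻¹ · w))
    where
    no-inversion : ∀ {t} → IsReflection t → N (v ⁻¹ · w) t ≡ false
    no-inversion {t} rt = trans (N-· (v ⁻¹) w t) (cong₂ _xor_ (trans (N-⁻¹ v t) (mv (refl-conj v rt))) (mw (refl-conj⁻¹ (v ⁻¹) rt)))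

    trivial : ∃[ a ] (prod a ≡ v ⁻¹ · w × Reduced a) → v ≡ w
    trivial ([] , eq , _) = trans (trans (sym (identityʳ v)) (cong (v ·_) eq)) (solve (v ∷ w ∷ []) [] (V 0 ⊙ (V 0 ⁻ ⊙ V 1)) (V 1) refl)
    trivial (i ∷ a , eq , p ∷ _) = contradiction (trans (sym (trans (cong (λ z → N z (s i)) (sym eq)) (trans (N-s· i (prod a)) (cong not p)))) (no-inversion (refl-s i))) λ ()

  longest-exists : ∃[ w ] IsLongest w
  longest-exists = argmax ℓ e elements , λ v n m Lv Lm →
    ≤-trans (≤-reflexive (sym (LenS⇒ℓ Lv))) (≤-trans (All.lookup (f[xs]≤f[argmax] e elements) (finite v)) (≤-reflexive (LenS⇒ℓ Lm)))

  ReducedFor⇒Reduced : ∀ {w a} → ReducedFor w a → Reduced a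
  ReducedFor⇒Reduced {a = a} (refl , L) = ℓ⇒Reduced a (LenS⇒ℓ L)

  Reduced⇒ReducedFor : ∀ {w a} → Reduced a → prod a ≡ w → ReducedFor w a
  Reduced⇒ReducedFor ra refl = refl , ℓ≡⇒LenS (Reduced⇒ℓ ra)

  LexLeq-antisym : ∀ {xs ys} → LexLeq xs ys → LexLeq ys xs → xs ≡ ys
  LexLeq-antisym nil       nil       = refl
  LexLeq-antisym (less p)  (less q)  = contradiction q (<-asym p)
  LexLeq-antisym (less p)  (equal _) = contradiction p (<-irrefl refl)
  LexLeq-antisym (equal _) (less q)  = contradiction q (<-irrefl refl)
  LexLeq-antisym (equal p) (equal q) = cong (_ ∷_) (LexLeq-antisym p q)

  -- Greedy construction of sorting words.

  module SortingWord (𝖼 : List (Fin r)) where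
    open Sorting 𝖼

    key-injective : ∀ {p q} → key p ≡ key q → p ≡ q
    key-injective {k , i} {k′ , i′} eq = cong₂ _,_ (*-cancelʳ-≡ k k′ L (+-cancelʳ-≡ (toℕ i) _ _ (trans eq (cong (λ j → k′ * L + toℕ j) (sym i≡i′))))) i≡i′
      where
      L = length 𝖼
      instance
        L≢0 : NonZero L
        L≢0 = nonZeroIndex i

      remainder : ∀ k (i : Fin L) → (k * L + toℕ i) % L ≡ toℕ i
      remainder k i = trans (cong (_% L) (+-comm (k * L) (toℕ i))) (trans ([m+kn]%n≡m%n (toℕ i) k L) (m<n⇒m%n≡m (toℕ<n i)))

      i≡i′ : i ≡ i′
      i≡i′ = toℕ-injective (trans (sym (remainder k i)) (trans (cong (_% L) eq) (remainder k′ i′)))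

    key-surjective : Fin (length 𝖼) → ∀ n → ∃[ p ] key p ≡ n
    key-surjective j n = (n / L , fromℕ< (m%n<n n L)) ,
      trans (cong (n / L * L +_) (toℕ-fromℕ< (m%n<n n L))) (trans (+-comm _ (n % L)) (sym (m≡m%n+[m/n]*n n L)))
      where
      L = length 𝖼
      instance
        L≢0 : NonZero L
        L≢0 = nonZeroIndex j

    -- Upward search from `m` with bound `d`. Each number is the key of exactly one position, so one
    -- test per number suffices.
    least : ∀ {P : Pos → Set} → (∀ p → Dec (P p)) → ∀ d m → (∃[ p ] (P p × m ≤ key p × key p ≤ d + m)) →
      ∃[ p ] (P p × m ≤ key p × (∀ q → P q → m ≤ key q → key p ≤ key q))
    least P? zero    m (p , Pp , m≤ , ≤m) = p , Pp , m≤ , λ q _ m≤q → ≤-trans ≤m m≤q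
    least {P} P? (suc d) m (p , Pp , m≤ , ≤m) with key-surjective (proj₂ p) m
    ... | p₀ , refl with P? p₀
    ...   | yes Pp₀ = p₀ , Pp₀ , ≤-refl , λ _ _ le → le
    ...   | no ¬Pp₀ = let p′ , Pp′ , le , minimal = least P? d (suc (key p₀)) (p , Pp , beyond Pp m≤ , ≤-trans ≤m (≤-reflexive (sym (+-suc d _))))
                      in p′ , Pp′ , ≤-trans (n≤1+n _) le , λ q Pq le′ → minimal q Pq (beyond Pq le′)
      where
      beyond : ∀ {q} → P q → key p₀ ≤ key q → key p₀ < key q
      beyond Pq le = ≤∧≢⇒< le λ eq → ¬Pp₀ (subst P (sym (key-injective eq)) Pq)

    data From : ℕ → List Pos → Set where
      []  : ∀ {m} → From m []
      _∷_ : ∀ {m p ps} → m ≤ key p → From (suc (key p)) ps → From m (p ∷ ps)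

    From⇒Subword : ∀ {m ps} → From m ps → Subword ps
    From⇒Subword []             = []
    From⇒Subword (_ ∷ [])       = [-]
    From⇒Subword (_ ∷ (q ∷ qs)) = q ∷ From⇒Subword (q ∷ qs)

    Subword⇒From : ∀ {ps} → Subword ps → From 0 ps
    Subword⇒From []  = []
    Subword⇒From [-] = z≤n ∷ []
    Subword⇒From (p ∷ ps) with Subword⇒From ps
    ... | _ ∷ qs = z≤n ∷ (p ∷ qs)

    head-descent : ∀ {i v w} → N v (s i) ≡ false → s i · v ≡ w → N w (s i) ≡ true
    head-descent {i} {v} p refl = trans (N-s· i v) (cong not p)

    -- The first position from `m` on whose letter is a left descent of `w` is taken. A competing
    -- reduced subword also begins with a left descent, hence no earlier; if it begins at the same
    -- position, the comparison passes to the tails.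
    greedy : (∀ i → i ∈ 𝖼) → ∀ n w m → ℓ w ≤ n → ∃[ ps ] (From m ps × prod (letters ps) ≡ w × Reduced (letters ps) ×
      (∀ qs → From m qs → prod (letters qs) ≡ w → Reduced (letters qs) → LexLeq (map key ps) (map key qs)))
    greedy all∈ n w m ℓw with reducedWord w
    ... | [] , eq , _ = [] , [] , eq , [] , λ _ _ _ _ → nil
    greedy all∈ (suc n) w m (s≤s ℓw) | i ∷ a , eq , Na ∷ ra
      with least {λ p → N w (s (lookup 𝖼 (proj₂ p))) ≡ true} (λ p → N w (s (lookup 𝖼 (proj₂ p))) ≟ᵇ true) _ m
             -- The search is bounded because the copy of `𝖼` with index `m` contains the descent
             -- `i`, and its keys are at least `m` as `𝖼` is nonempty.
             ((m , Any.index (all∈ i)) , subst (λ j → N w (s j) ≡ true) (lookup-index (all∈ i)) (head-descent Na eq) ,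
              ≤-trans (m≤m*n m (length 𝖼) {{nonZeroIndex (Any.index (all∈ i))}}) (m≤m+n _ _) , m≤m+n _ m)
    ... | p , Np , m≤p , minimal with greedy all∈ n (s j · w) (suc (key p)) shorter
      where
      j = lookup 𝖼 (proj₂ p)

      shorter : ℓ (s j · w) ≤ n
      shorter = ≤-trans (≤-pred (≤-trans (N-true⇒ℓ< Np) (≤-trans (≤-reflexive (cong ℓ (sym eq))) (ℓ-minimal (i ∷ a))))) ℓw
    ...   | ps , fr , eqp , rp , lex = p ∷ ps , m≤p ∷ fr , trans (cong (s j ·_) eqp) ssw ,
            trans (cong (λ z → N z (s j)) eqp) (trans (N-s· j w) (cong not Np)) ∷ rp , compare
      where
      j = lookup 𝖼 (proj₂ p)

      ssw : s j · (s j · w) ≡ w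
      ssw = solve (w ∷ []) (σ j ∷ []) (I 0 ⊙ (I 0 ⊙ V 0)) (V 0) refl

      compare : ∀ qs → From m qs → prod (letters qs) ≡ w → Reduced (letters qs) → LexLeq (map key (p ∷ ps)) (map key qs)
      compare [] _ eqq _ = contradiction (trans (sym Np) (trans (cong (λ z → N z (s j)) (sym eqq)) (N-e _))) λ ()
      compare (q ∷ qs) (m≤q ∷ fq) eqq (Nq ∷ rq) with m≤n⇒m<n∨m≡n (minimal q (head-descent Nq eqq) m≤q)
      ... | inj₁ lt = less lt
      ... | inj₂ keys with key-injective {p} {q} keys
      ...   | refl = equal (lex qs fq (trans (solve (prod (letters qs) ∷ []) (σ j ∷ []) (V 0) (I 0 ⊙ (I 0 ⊙ V 0)) refl) (cong (s j ·_) eqq)) rq)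

    sorting-exists : (∀ i → i ∈ 𝖼) → ∀ w → ∃[ ps ] SortingPositions w ps
    sorting-exists all∈ w with greedy all∈ (ℓ w) w 0 ≤-refl
    ... | ps , fr , eq , rp , lex = ps , From⇒Subword fr , Reduced⇒ReducedFor rp eq ,
          λ qs sub red → lex qs (Subword⇒From sub) (proj₁ red) (ReducedFor⇒Reduced red)

    sorting-unique : ∀ {w ps qs} → SortingPositions w ps → SortingPositions w qs → ps ≡ qs
    sorting-unique (subp , redp , lexp) (subq , redq , lexq) =
      map-injective key-injective (LexLeq-antisym (lexp _ subq redq) (lexq _ subp redp))

    module _ {w₀ ps} (longest : IsLongest w₀) (sorted : SortingPositions w₀ ps) where

      -- Longest elements and sorting positions are unique, so `≼` refers to the commutation class
      -- of this one word, in which a non-commuting pair keeps its order.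
      precedes⇒≼ : ∀ {t t′} → ¬ Commute t t′ → (t ∷ t′ ∷ []) ⊆ inversions (letters ps) → t ≼[ 𝖼 ] t′
      precedes⇒≼ ¬c p w longest′ qs sorted′ a comm with Maximal-unique (IsLongest⇒Maximal longest) (IsLongest⇒Maximal longest′)
      ... | refl with sorting-unique sorted sorted′
      ...   | refl = precedes⇒LeftOf (CommEqBy-precedes ¬c comm p)

      ≼-refl : ∀ {t} → IsReflection t → t ≼[ 𝖼 ] t
      ≼-refl rt w longest′ qs (_ , red , _) a comm = ∈⇒LeftOf (CommEqBy-∈ comm
        (N⇒∈-inversions (letters qs) (trans (cong (λ z → N z _) (proj₁ red)) (IsLongest⇒Maximal longest′ rt))))

      -- `≼` applies in particular to the sorting word itself, whose inversions are distinct and so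
      -- cannot occur in both orders.
      precedes⇒⋠ : ∀ {t t′} → (t ∷ t′ ∷ []) ⊆ inversions (letters ps) → ¬ (t′ ≼[ 𝖼 ] t)
      precedes⇒⋠ {t} {t′} p le = precedes-asym unique p (LeftOf⇒precedes _ t′≢t (le w₀ longest ps sorted (letters ps) ε))
        where
        unique : Unique (inversions (letters ps))
        unique = inversions-unique (ReducedFor⇒Reduced (proj₁ (proj₂ sorted)))

        t′≢t : t′ ≢ t
        t′≢t refl = precedes-asym unique p p

  -- Concordant chains

  -- With `a = w · s i · w ⁻¹` commuting with `b`, the contributions of `w` and `w ⁻¹` agree, and
  -- the middle one vanishes because `a ≢ b`.
  N-commuting : ∀ {a b} → IsReflection a → a ≢ b → Commute a b → N a b ≡ false
  N-commuting {_} {b} (w , i , refl) a≢b c = begin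
    N (w · s i · w ⁻¹) b
      ≡⟨ N-· (w · s i) (w ⁻¹) b ⟩
    N (w · s i) b xor N (w ⁻¹) ((w · s i) ⁻¹ · b · (w · s i))
      ≡⟨ cong₂ _xor_ (N-· w (s i) b) (trans (cong (N (w ⁻¹)) fixed) (trans (N-⁻¹ w b′) (cong (N w) back))) ⟩
    (N w b xor N (s i) b′) xor N w b
      ≡⟨ cong (λ z → (N w b xor z) xor N w b) (trans (N-s i b′) (==-false λ p → a≢b (trans (cong (λ z → w · z · w ⁻¹) (sym p)) back))) ⟩
    (N w b xor false) xor N w b
      ≡⟨ cong (_xor N w b) (xor-comm (N w b) false) ⟩
    N w b xor N w b
      ≡⟨ xor-same (N w b) ⟩
    false ∎
    where
    open ≡-Reasoning
    b′ = w ⁻¹ · b · w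

    back : w · b′ · w ⁻¹ ≡ b
    back = solve (w ∷ b ∷ []) [] (V 0 ⊙ (V 0 ⁻ ⊙ V 1 ⊙ V 0) ⊙ V 0 ⁻) (V 1) refl

    fixed : (w · s i) ⁻¹ · b · (w · s i) ≡ b′
    fixed = trans (solve (w ∷ b ∷ []) (σ i ∷ []) ((V 0 ⊙ I 0) ⁻ ⊙ V 1 ⊙ (V 0 ⊙ I 0)) (V 0 ⁻ ⊙ ((V 0 ⊙ I 0 ⊙ V 0 ⁻) ⊙ V 1) ⊙ (V 0 ⊙ I 0)) refl)
      (trans (cong (λ z → w ⁻¹ · z · (w · s i)) c)
        (solve (w ∷ b ∷ []) (σ i ∷ []) (V 0 ⁻ ⊙ (V 1 ⊙ (V 0 ⊙ I 0 ⊙ V 0 ⁻)) ⊙ (V 0 ⊙ I 0)) (V 0 ⁻ ⊙ V 1 ⊙ V 0) refl))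

  R-commuting : ∀ {a b} y → IsReflection a → a ≢ b → Commute a b → R (y · a) b ≡ R y b
  R-commuting {a} {b} y ra a≢b c = trans (R-· y a b) (cong₂ _xor_
    (trans (cong (λ z → N z b) (solve [] (τ ra ∷ []) (I 0 ⁻) (I 0) refl)) (N-commuting ra a≢b c))
    (cong (R y) (trans (cong (_· a ⁻¹) c) (solve (a ∷ b ∷ []) [] (V 1 ⊙ V 0 ⊙ V 0 ⁻) (V 1) refl))))

  Down-swap : ∀ {xs ys y} → SwapBy Commute xs ys → All IsReflection xs → Down y xs → Down y ys
  Down-swap (there p) (_ ∷ rs) (d ∷ ds) = d ∷ Down-swap p rs ds
  Down-swap {y = y} (here {a} {b} {xs} c) (ra ∷ rb ∷ _) (da ∷ db ∷ ds) =
    trans (sym (R-commuting y ra a≢b c)) db ∷ trans (R-commuting y rb (λ q → a≢b (sym q)) (sym c)) da ∷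
    subst (λ z → Down z xs) (trans (assoc y a b) (trans (cong (y ·_) c) (sym (assoc y b a)))) ds
    where
    -- Two equal letters in succession would go down and then back up.
    a≢b : a ≢ b
    a≢b refl = contradiction (trans (sym db) (trans (R-·t ra y) (cong not da))) λ ()

  All-swap : ∀ {Q : W → Set} {xs ys} → SwapBy Commute xs ys → All Q xs → All Q ys
  All-swap (here _)  (p ∷ q ∷ qs) = q ∷ p ∷ qs
  All-swap (there s) (p ∷ ps)     = p ∷ All-swap s ps

  length-swap : ∀ {xs ys} → SwapBy Commute xs ys → length xs ≡ length ys
  length-swap (here _)  = refl
  length-swap (there s) = cong suc (length-swap s)

  prodW-swap : ∀ {xs ys} → SwapBy Commute xs ys → prodW xs ≡ prodW ys
  prodW-swap (here {a} {b} {xs} c) = trans (sym (assoc a b _)) (trans (cong (_· prodW xs) c) (assoc b a _))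
  prodW-swap (there s)        = cong (_ ·_) (prodW-swap s)

  CommEqBy-Down : ∀ {xs ys y} → CommEqBy Commute xs ys → All IsReflection xs → Down y xs →
    Down y ys × length xs ≡ length ys × prodW xs ≡ prodW ys
  CommEqBy-Down ε        rs d = d , refl , refl
  CommEqBy-Down (p ◅ ps) rs d with CommEqBy-Down ps (All-swap p rs) (Down-swap p rs d)
  ... | d′ , len , eq = d′ , trans (length-swap p) len , trans (prodW-swap p) eq

  prodW-reverse : ∀ {ts} → All IsReflection ts → prodW (reverse ts) ≡ prodW ts ⁻¹
  prodW-reverse [] = sym ε⁻¹≈ε
  prodW-reverse {t ∷ ts} (rt ∷ rts) rewrite unfold-reverse t ts = trans (prodW-++ (reverse ts) (t ∷ []))
    (trans (cong (_· prodW (t ∷ [])) (prodW-reverse rts)) (solve (prodW ts ∷ []) (τ rt ∷ []) (V 0 ⁻ ⊙ (I 0 ⊙ ⟨e⟩)) ((I 0 ⊙ V 0) ⁻) refl))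

  Up-∷ʳ : ∀ {y t} xs → Up y xs → R (y · prodW xs) t ≡ false → Up y (xs ++ t ∷ [])
  Up-∷ʳ {y} []       []       p = trans (cong (λ z → R z _) (sym (identityʳ y))) p ∷ []
  Up-∷ʳ {y} (x ∷ xs) (u ∷ us) p = u ∷ Up-∷ʳ xs us (trans (cong (λ z → R z _) (assoc y x (prodW xs))) p)

  Down-∷ʳ : ∀ {y t} xs → Down y xs → R (y · prodW xs) t ≡ true → Down y (xs ++ t ∷ [])
  Down-∷ʳ {y} []       []       p = trans (cong (λ z → R z _) (sym (identityʳ y))) p ∷ []
  Down-∷ʳ {y} (x ∷ xs) (u ∷ us) p = u ∷ Down-∷ʳ xs us (trans (cong (λ z → R z _) (assoc y x (prodW xs))) p)

  R-before-last : ∀ {t ts b} y → IsReflection t → All IsReflection ts → R y t ≡ b → R (y · (t · prodW ts) · prodW (reverse ts)) t ≡ not b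
  R-before-last {t} {ts} y rt rts refl = trans (cong (λ z → R z t)
      (trans (cong (y · (t · prodW ts) ·_) (prodW-reverse rts)) (solve (y ∷ t ∷ prodW ts ∷ []) [] (V 0 ⊙ (V 1 ⊙ V 2) ⊙ V 2 ⁻) (V 0 ⊙ V 1) refl)))
    (R-·t rt y)

  Down⇒Up-reverse : ∀ {y ts} → All IsReflection ts → Down y ts → Up (y · prodW ts) (reverse ts)
  Down⇒Up-reverse [] [] = []
  Down⇒Up-reverse {y} {t ∷ ts} (rt ∷ rts) (d ∷ ds) rewrite unfold-reverse t ts =
    Up-∷ʳ (reverse ts) (subst (λ z → Up z (reverse ts)) (assoc _ _ _) (Down⇒Up-reverse rts ds)) (R-before-last y rt rts d)

  Up⇒Down-reverse : ∀ {y ts} → All IsReflection ts → Up y ts → Down (y · prodW ts) (reverse ts)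
  Up⇒Down-reverse [] [] = []
  Up⇒Down-reverse {y} {t ∷ ts} (rt ∷ rts) (u ∷ us) rewrite unfold-reverse t ts =
    Down-∷ʳ (reverse ts) (subst (λ z → Down z (reverse ts)) (assoc _ _ _) (Up⇒Down-reverse rts us)) (R-before-last y rt rts u)

  prod-reverse : ∀ a → prod (reverse a) ≡ prod a ⁻¹
  prod-reverse a = trans (sym (prodW-simple (reverse a))) (trans (cong prodW (reverse-map s a))
    (trans (prodW-reverse (simple-reflections a)) (cong _⁻¹ (prodW-simple a))))

  -- Increasing and decreasing chains for a fixed Coxeter element.

  module _ (𝖼 : List (Fin r)) (perm : 𝖼 ↭ allFin r) where
    open Sorting 𝖼
    open SortingWord 𝖼

    private
      c : W
      c = prod 𝖼

      length-𝖼 : length 𝖼 ≡ r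
      length-𝖼 = trans (↭-length perm) (length-tabulate (λ i → i))

      LenT-c : LenT c r
      LenT-c = subst (LenT c) length-𝖼 (LenT-unique-word (PermutationProperties.Unique-resp-↭ (setoid (Fin r)) (↭⇒↭ₛ (↭-sym perm)) (allFin⁺ r)))

      w₀ : W
      w₀ = proj₁ longest-exists

      longest : IsLongest w₀
      longest = proj₂ longest-exists

      N-w₀ : Maximal w₀
      N-w₀ = IsLongest⇒Maximal longest

      R-w₀ : ∀ {t} → IsReflection t → R w₀ t ≡ true
      R-w₀ {t} rt = trans (N-⁻¹ w₀ t) (N-w₀ (refl-conj w₀ rt))

      sorting : ∃[ ps ] SortingPositions w₀ ps
      sorting = sorting-exists (λ i → ∈-resp-↭ (↭-sym perm) (∈-allFin i)) w₀

      sorted : SortingPositions w₀ (proj₁ sorting)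
      sorted = proj₂ sorting

      a₀ : List (Fin r)
      a₀ = letters (proj₁ sorting)

      reduced-a₀ : Reduced a₀
      reduced-a₀ = ReducedFor⇒Reduced (proj₁ (proj₂ sorted))

      prod-a₀ : prod a₀ ≡ w₀
      prod-a₀ = proj₁ (proj₁ (proj₂ sorted))

      T₀ : List W
      T₀ = inversions a₀

    record Descent (v u : W) (k : ℕ) (ts : List W) : Set where
      constructor descent
      field
        sub  : ts ⊆ T₀
        size : length ts ≡ k
        down : Down v ts
        end  : v · prodW ts ≡ u

    open Descent

    -- Dyer: a Bruhat interval has exactly one maximal chain whose labels, read downwards,
    -- increase for the reflection order given by a reduced word of w₀.
    unique-descent : ∀ u γ → ℓ u + length γ ≤ ℓ (u · prod γ) →
      ∃[ ts ] (Descent (u · prod γ) u (length γ) ts × (∀ ts′ → Descent (u · prod γ) u (length γ) ts′ → ts ≡ ts′))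
    unique-descent u γ additive = along (reducedWord u) additive
      where
      along : ∃[ β ] (prod β ≡ u × Reduced β) → ℓ u + length γ ≤ ℓ (u · prod γ) →
        ∃[ ts ] (Descent (u · prod γ) u (length γ) ts × (∀ ts′ → Descent (u · prod γ) u (length γ) ts′ → ts ≡ ts′))
      along (β , refl , rβ) additive = let ts , w = find a₀ (length γ) v asc (≤-reflexive (sym count)) in
          ts , fromWalk w , λ ts′ d → unique asc (≤-reflexive count) w (toWalk d)
        where
        open Walks (prod β · w₀)
        v = prod β · prod γ

        asc : Ascending e a₀
        asc = Reduced⇒Ascending reduced-a₀

        rβγ : Reduced (β ++ γ)
        rβγ = ℓ⇒Reduced (β ++ γ) (≤-antisym (ℓ-minimal (β ++ γ))
          (≤-trans (≤-reflexive (trans (length-++ β) (cong (_+ length γ) (sym (Reduced⇒ℓ rβ)))))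
            (≤-trans additive (≤-reflexive (cong ℓ (sym (prod-++ β γ)))))))

        count : ρ* a₀ (indicator (prod β · w₀)) (length γ) (v · e) ≡ 1
        count = trans (cong (ρ* a₀ (indicator (prod β · w₀)) (length γ)) (trans (identityʳ v) (sym (prod-++ β γ))))
          (Longest.count-one w₀ N-w₀ reduced-a₀ prod-a₀ β γ rβγ)

        e·a₀ : e · prod a₀ ≡ w₀
        e·a₀ = trans (identityˡ _) prod-a₀

        fromWalk : ∀ {ts} → Walk e a₀ (length γ) v ts → Descent v (prod β) (length γ) ts
        fromWalk {ts} (walk sb sz d en) = descent (subst (_ ⊆_) (sym (inversions≡labels a₀)) sb) sz d
          (∙-cancelʳ w₀ _ _ (trans (cong (v · prodW ts ·_) (sym e·a₀)) en))

        toWalk : ∀ {ts} → Descent v (prod β) (length γ) ts → Walk e a₀ (length γ) v ts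
        toWalk (descent sb sz d en) = walk (subst (_ ⊆_) (inversions≡labels a₀) sb) sz d (cong₂ _·_ en e·a₀)

    ⊆⇒reflections : ∀ {ts} → ts ⊆ T₀ → All IsReflection ts
    ⊆⇒reflections sb = All-resp-⊆ sb (inversions-reflections a₀)

    ⊆⇒⋠ : ∀ {ts} → ts ⊆ T₀ → AllPairs (λ x y → ¬ (y ≼[ 𝖼 ] x)) ts
    ⊆⇒⋠ sb = AllPairs.map (precedes⇒⋠ longest sorted) (AllPairs-⊆ sb (precedes-self T₀))

    TReduced-factorization : ∀ {ts} → All IsReflection ts → length ts ≡ r → prodW ts ≡ c → TReduced ts
    TReduced-factorization rts len eq = treduced rts λ us rus eq′ → ≤-trans (≤-reflexive len) (proj₂ LenT-c us rus (trans eq′ eq))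

    -- Left multiplication by `w₀` complements right inversions, so each ascent of `p` becomes a
    -- descent of `w₀ · p`.
    w₀-antitone : ∀ {p a} → Ascending p a → ℓ (w₀ · (p · prod a)) + length a ≤ ℓ (w₀ · p)
    w₀-antitone {p} [] = ≤-reflexive (trans (+-identityʳ _) (cong (λ z → ℓ (w₀ · z)) (identityʳ p)))
    w₀-antitone {p} {i ∷ a} (up ∷ asc) = begin
      ℓ (w₀ · (p · (s i · prod a))) + suc (length a) ≡⟨ +-suc _ (length a) ⟩
      suc (ℓ (w₀ · (p · (s i · prod a))) + length a) ≡⟨ cong (λ z → suc (ℓ (w₀ · z) + length a)) (sym (assoc _ _ _)) ⟩
      suc (ℓ (w₀ · (p · s i · prod a)) + length a)   ≤⟨ s≤s (w₀-antitone asc) ⟩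
      suc (ℓ (w₀ · (p · s i)))                       ≡⟨ cong (λ z → suc (ℓ z)) (sym (assoc _ _ _)) ⟩
      suc (ℓ (w₀ · p · s i))                         ≤⟨ R-true⇒ℓ< (trans (R-· w₀ p (s i)) (cong₂ _xor_ up (R-w₀ (refl-conj p (refl-s i))))) ⟩
      ℓ (w₀ · p)                                     ∎
      where open ≤-Reasoning

    w₀-Down⇒Up : ∀ {y ts} → All IsReflection ts → Down (w₀ · y) ts → Up y ts
    w₀-Down⇒Up [] [] = []
    w₀-Down⇒Up {y} {t ∷ ts} (rt ∷ rts) (d ∷ ds) = up (trans (sym (R-· w₀ y t)) d) ∷ w₀-Down⇒Up rts (subst (λ z → Down z ts) (assoc _ _ _) ds)
      where
      up : R y t xor R w₀ (y · t · y ⁻¹) ≡ true → R y t ≡ false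
      up p rewrite R-w₀ (refl-conj y rt) with R y t
      ... | false = refl
      up () | true

    module _ (u : W) (u∈ : InWcPlus c u) where

      private
        additive : ℓ (u · c) ≡ ℓ u + r
        additive = let n , Lu , Luc = u∈ in trans (LenS⇒ℓ Luc) (cong (_+ r) (sym (LenS⇒ℓ Lu)))

        additive-𝖼 : ℓ u + length 𝖼 ≤ ℓ (u · c)
        additive-𝖼 = ≤-reflexive (trans (cong (ℓ u +_) length-𝖼) (sym additive))

        undo : w₀ · (u · c) · prod (reverse 𝖼) ≡ w₀ · u
        undo = trans (cong (w₀ · (u · c) ·_) (prod-reverse 𝖼)) (solve (w₀ ∷ u ∷ c ∷ []) [] (V 0 ⊙ (V 1 ⊙ V 2) ⊙ V 2 ⁻) (V 0 ⊙ V 1) refl)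

      module _ {ts} (rts : All IsReflection ts) (len : length ts ≡ r) (eq : prodW ts ≡ c) (up : Up u ts) where

        scan-MaxChain : MaxChain c (scan e ts)
        scan-MaxChain = TReduced⇒MaxChain (TReduced-factorization rts len eq) eq

        scan-Concordant : Concordant u (scan e ts)
        scan-Concordant = Up⇒Concordant u e rts (subst (λ z → Up z ts) (sym (identityʳ u)) up)
          (≤-reflexive (trans (cong₂ (λ y z → ℓ (y · z)) (identityʳ u) eq)
            (trans additive (cong₂ (λ y n → ℓ y + n) (sym (identityʳ u)) (sym len)))))

      -- `unique-descent` gives labels in the order of `T₀` when read downwards, whereas an
      -- increasing chain needs this order upwards. Left multiplication by `w₀` turns the interval
      -- upside down and keeps the labels, so the descent is taken from `w₀ · u` to `w₀ · (u · c)`.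
      increasing-chain : ∃[ π ] (MaxChain c π × Increasing 𝖼 π × Concordant u π)
      increasing-chain with unique-descent (w₀ · (u · c)) (reverse 𝖼)
          (≤-trans (≤-reflexive (cong (ℓ (w₀ · (u · c)) +_) (length-reverse 𝖼)))
            (≤-trans (w₀-antitone (ℓ-additive⇒Ascending u 𝖼 additive-𝖼)) (≤-reflexive (cong ℓ (sym undo)))))
      ... | ts , d , _ = scan e ts , scan-MaxChain rts len eq up ,
            subst (AllPairs _) (sym (rwFrom-scan e ts)) (⊆⇒⋠ (sub d)) , scan-Concordant rts len eq up
        where
        rts : All IsReflection ts
        rts = ⊆⇒reflections (sub d)

        len : length ts ≡ r
        len = trans (size d) (trans (length-reverse 𝖼) length-𝖼)

        up : Up u ts
        up = w₀-Down⇒Up rts (subst (λ z → Down z ts) undo (down d))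

        eq : prodW ts ≡ c
        eq = ∙-cancelˡ (w₀ · u) _ _ (trans (cong (_· prodW ts) (sym undo)) (trans (end d) (sym (assoc w₀ u c))))

      -- The descent from `u · c` to `u` is read in reverse. For uniqueness, the reversed word of
      -- any other such chain is sorted into the order of `T₀` by commutations; the result is again
      -- a descent and must equal `ts`.
      decreasing-chain : ∃[ π ] (MaxChain c π × Decreasing 𝖼 π × Concordant u π
        × (∀ π′ → MaxChain c π′ → Decreasing 𝖼 π′ → Concordant u π′ → CommEquiv π π′))
      decreasing-chain with unique-descent u 𝖼 additive-𝖼
      ... | ts , d , unique = scan e (reverse ts) , scan-MaxChain (All-reverse rts) len eq up ,
            subst (AllPairs _) (sym (rwFrom-scan e (reverse ts))) (AllPairs-reverse (⊆⇒⋠ (sub d))) ,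
            scan-Concordant (All-reverse rts) len eq up ,
            λ π′ chain dec conc → subst (λ z → CommEqBy Commute z (rw π′)) (sym (rwFrom-scan e (reverse ts))) (equivalent π′ chain dec conc)
        where
        rts : All IsReflection ts
        rts = ⊆⇒reflections (sub d)

        len : length (reverse ts) ≡ r
        len = trans (length-reverse ts) (trans (size d) length-𝖼)

        up : Up u (reverse ts)
        up = subst (λ z → Up z (reverse ts)) (end d) (Down⇒Up-reverse rts (down d))

        eq : prodW (reverse ts) ≡ c
        eq = trans (prodW-reverse rts) (sym (inverseˡ-unique c (prodW ts)
          (∙-cancelˡ u _ _ (trans (sym (assoc u c (prodW ts))) (trans (end d) (sym (identityʳ u)))))))

        equivalent : ∀ π′ → MaxChain c π′ → Decreasing 𝖼 π′ → Concordant u π′ → CommEqBy Commute (reverse ts) (rw π′)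
        equivalent π′ (linked , last) dec conc with ⋖T-chain π′ linked LenT-e
        ... | rσ , L , prodσ with sort {comm = Commute} _≟_ T₀ (reverse (rw π′)) distinct members inverted
          where
          -- `≼` is reflexive on reflections, so a decreasing chain repeats no label.
          distinct : Unique (reverse (rw π′))
          distinct = AllPairs.map (λ p q → p (sym q)) (AllPairs-reverse (irreflexive rσ dec))
            where
            irreflexive : ∀ {xs} → All IsReflection xs → AllPairs (λ x y → ¬ (x ≼[ 𝖼 ] y)) xs → Unique xs
            irreflexive []         []       = []
            irreflexive (rt ∷ rts) (p ∷ ps) = All.map (λ { ¬le refl → ¬le (≼-refl longest sorted rt) }) p ∷ irreflexive rts ps

          members : All (_∈ T₀) (reverse (rw π′))
          members = All-reverse (All.map (λ rt → N⇒∈-inversions a₀ (trans (cong (λ z → N z _) prod-a₀) (N-w₀ rt))) rσ)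

          -- A non-commuting pair would be ordered by `≼` as in `T₀`, against the chain being
          -- decreasing.
          inverted : AllPairs (λ x y → (y ∷ x ∷ []) ⊆ T₀ → Commute x y) (reverse (rw π′))
          inverted = AllPairs.map (λ {x} {y} ¬le p → decide x y ¬le p) (AllPairs-reverse dec)
            where
            decide : ∀ x y → ¬ (y ≼[ 𝖼 ] x) → (y ∷ x ∷ []) ⊆ T₀ → Commute x y
            decide x y ¬le p with (x · y) ≟ (y · x)
            ... | yes q = q
            ... | no ¬q = contradiction (precedes⇒≼ longest sorted (λ q → ¬q (sym q)) p) ¬le
        ...   | ts′ , ts′⊆ , comm with CommEqBy-Down comm (All-reverse rσ) (Up⇒Down-reverse rσ (Concordant⇒Up u π′ conc))
        ...     | down′ , len′ , prod′ with unique ts′ (descent ts′⊆ size′ (subst (λ z → Down z ts′) uσ down′) end′)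
          where
          σc : prodW (rw π′) ≡ c
          σc = trans (sym (identityˡ _)) (trans prodσ last)

          uσ : u · e · prodW (rw π′) ≡ u · c
          uσ = cong₂ _·_ (identityʳ u) σc

          size′ : length ts′ ≡ length 𝖼
          size′ = trans (sym len′) (trans (length-reverse (rw π′))
            (trans (LenT-unique (subst (λ z → LenT z (length (rw π′))) last L) LenT-c) (sym length-𝖼)))

          end′ : u · c · prodW ts′ ≡ u
          end′ = trans (cong (u · c ·_) (trans (sym prod′) (trans (prodW-reverse rσ) (cong _⁻¹ σc))))
            (solve (u ∷ c ∷ []) [] (V 0 ⊙ V 1 ⊙ V 1 ⁻) (V 0) refl)
        ...       | refl = CommEqBy-sym sym (subst (λ z → CommEqBy Commute z (reverse ts)) (reverse-involutive (rw π′)) (CommEqBy-reverse sym comm))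

-- A chain stands for its commutation class, on which concordance is constant. As there is only one
-- increasing class, it is concordant with `u` exactly when some increasing chain is.
theorem1p8 : (C : FiniteCoxeterSystem) →
  let open FiniteCoxeterSystem C
      open Notions C
  in (𝖼 : List (Fin rank)) → 𝖼 ↭ allFin rank →
     (u : W) → InWcPlus (prod 𝖼) u →
     (∃[ π ] (MaxChain (prod 𝖼) π × Increasing 𝖼 π × Concordant u π))
     × (∃[ π ] (MaxChain (prod 𝖼) π × Decreasing 𝖼 π × Concordant u π
                × (∀ π′ → MaxChain (prod 𝖼) π′ → Decreasing 𝖼 π′ → Concordant u π′ → CommEquiv π π′)))
theorem1p8 C 𝖼 perm u u∈ = increasing-chain 𝖼 perm u u∈ , decreasing-chain 𝖼 perm u u∈
  where open Coxeter C
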